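{- Let $n$ and $k$ be integers with $0\le k\le n-3$. Among all connected graphs with $n$ vertices and exactly $k$ cut edges, the first graph in the $S$-order is uniquely $P_n^k$; that is, $P_n^k\in\mathscr{G}_n^k$ and $P_n^k\prec_s G$ for every $G\in\mathscr{G}_n^k$ not isomorphic to $P_n^k$.
   Context: All graphs are finite, simple, undirected and connected. A cut edge of a connected graph is an edge whose deletion breaks the graph into two components. $\mathscr{G}_n^k$ is the set of all connected $n$-vertex graphs with exactly $k$ cut edges (graphs are considered up to isomorphism). For an $n$-vertex graph $G$ with adjacency eigenvalues $\lambda_1(G)\ge\dots\ge\lambda_n(G)$, the $i$th spectral moment is $S_i(G)=\sum_{j=1}^n\lambda_j(G)^i$ for $i=0,1,\dots,n-1$. For two $n$-vertex graphs $G_1,G_2$, write $G_1\prec_s G_2$ ($G_1$ comes before $G_2$ in the $S$-order) if for some $j\in\{1,\dots,n-1\}$ we have $S_i(G_1)=S_i(G_2)$ for $i=0,1,\dots,j-1$ and $S_j(G_1)<S_j(G_2)$. $P_m$ and $C_m$ are the path and the cycle on $m$ vertices. $P_n^k$ is the $n$-vertex graph obtained by identifying one end-vertex of the path $P_{k+1}$ with one vertex of the cycle $C_{n-k}$ (so $P_n^0=C_n$). -}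

module Defs where

open import Algebra.Apartness.Bundles using (HeytingField)
open import Algebra.Bundles using (CommutativeRing; Semiring)
import Algebra.Definitions.RawSemiring as RawSemiringDefs
import Algebra.Definitions.RawMonoid as RawMonoidDefs
open import Data.Fin as Fin using (Fin; toℕ)
open import Data.Fin.Permutation using (Permutation′; _⟨$⟩ʳ_)
open import Data.List using (List; length)
open import Data.List.Membership.Propositional using (_∈_)
open import Data.List.Relation.Unary.Unique.Propositional using (Unique)
open import Data.Nat as ℕ using (ℕ; suc; _∸_)
import Data.Nat.Properties as ℕₚ
open import Data.Product using (Σ; ∃-syntax; _×_; _,_)
open import Data.Sum using (_⊎_; inj₁; inj₂)
open import Data.Vec.Functional using (Vector)
open import Function.Bundles using (_⇔_)
open import Level using (0ℓ; _⊔_) renaming (suc to lsuc)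
open import Relation.Binary.Construct.Closure.ReflexiveTransitive using (Star)
open import Relation.Binary.Construct.Closure.Symmetric using (SymClosure; fwd; bwd; symmetric)
open import Relation.Binary.Core using (Rel)
open import Relation.Binary.Definitions using (Symmetric; Irreflexive; Decidable)
open import Relation.Binary.PropositionalEquality using (_≡_; refl; sym; trans; cong; subst)
open import Relation.Binary.Structures using (IsStrictPartialOrder)
open import Relation.Nullary using (¬_; yes; no; does)
open import Relation.Nullary.Decidable using (_×-dec_; _⊎-dec_)
open import Data.Bool using (if_then_else_)

record Graph (n : ℕ) : Set₁ where
  field
    Edge        : Rel (Fin n) 0ℓ
    edge?       : Decidable Edge
    edge-sym    : Symmetric Edge
    edge-irrefl : Irreflexive _≡_ Edge

open Graph public

_≅_ : ∀ {n} → Graph n → Graph n → Set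
_≅_ {n} G H = Σ (Permutation′ n) λ π →
  ∀ u v → Edge G u v ⇔ Edge H (π ⟨$⟩ʳ u) (π ⟨$⟩ʳ v)

Connected : ∀ {n} → Graph n → Set
Connected G = ∀ u v → Star (Edge G) u v

-- The edge relation after deleting the undirected edge {u , v}.
DeleteEdge : ∀ {n} → Graph n → Fin n → Fin n → Rel (Fin n) 0ℓ
DeleteEdge G u v x y =
  Edge G x y × ¬ ((x ≡ u × y ≡ v) ⊎ (x ≡ v × y ≡ u))

-- x and y represent the two components.
TwoComponents : ∀ {n} → Rel (Fin n) 0ℓ → Set
TwoComponents R = ∃[ x ] ∃[ y ] (¬ Star R x y × (∀ z → Star R x z ⊎ Star R y z))

CutEdge : ∀ {n} → Graph n → Fin n → Fin n → Set
CutEdge G u v = Edge G u v × TwoComponents (DeleteEdge G u v)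

-- An undirected edge {u , v} is counted once, as the pair with u < v.
HasCutEdges : ∀ {n} → Graph n → ℕ → Set
HasCutEdges {n} G k = Σ (List (Fin n × Fin n)) λ es →
  Unique es
  × (∀ u v → ((u , v) ∈ es) ⇔ (u Fin.< v × CutEdge G u v))
  × length es ≡ k

𝒢 : ∀ n (k : ℕ) → Graph n → Set
𝒢 n k G = Connected G × HasCutEdges G k

-- The cycle C_{n-k} occupies the vertices 0 , … , n-k-1 and the path P_{k+1}
-- occupies n-k-1 , … , n-1; they share the vertex n-k-1.  So the edges are
-- the steps i — i+1, together with the edge 0 — n-k-1 closing the cycle.
Arc : ∀ n → ℕ → Rel (Fin n) 0ℓ
Arc n k i j = (toℕ j ≡ suc (toℕ i)) ⊎ (toℕ i ≡ 0 × suc (toℕ j) ≡ n ∸ k)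

private
  arc? : ∀ n k → Decidable (Arc n k)
  arc? n k i j =
    (toℕ j ℕ.≟ suc (toℕ i)) ⊎-dec ((toℕ i ℕ.≟ 0) ×-dec (suc (toℕ j) ℕ.≟ n ∸ k))

  symClosure? : ∀ {n} {R : Rel (Fin n) 0ℓ} → Decidable R → Decidable (SymClosure R)
  symClosure? R? i j with R? i j | R? j i
  ... | yes r | _     = yes (fwd r)
  ... | no _  | yes r = yes (bwd r)
  ... | no ¬r | no ¬s = no λ { (fwd r) → ¬r r ; (bwd s) → ¬s s }

  arc-irrefl : ∀ n k → k ℕ.+ 3 ℕ.≤ n → ∀ i → ¬ Arc n k i i
  arc-irrefl n k h i (inj₁ eq) = ℕₚ.1+n≢n (sym eq)
  arc-irrefl n k h i (inj₂ (i≡0 , eq)) =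
    ℕₚ.<⇒≢ (ℕₚ.≤-trans (ℕ.s≤s (ℕ.s≤s ℕ.z≤n)) (ℕₚ.m+n≤o⇒m≤o∸n 3 (subst (ℕ._≤ n) (ℕₚ.+-comm k 3) h)))
           (trans (cong suc (sym i≡0)) eq)

P : ∀ n k → k ℕ.+ 3 ℕ.≤ n → Graph n
P n k h = record
  { Edge        = SymClosure (Arc n k)
  ; edge?       = symClosure? (arc? n k)
  ; edge-sym    = symmetric (Arc n k)
  ; edge-irrefl = λ { refl (fwd a) → arc-irrefl n k h _ a
                    ; refl (bwd a) → arc-irrefl n k h _ a }
  }

-- Cauchy-complete Archimedean ordered fields.  Classically there is exactly
-- one up to isomorphism; constructively the order is not assumed decidable,
-- so that the Cauchy reals qualify.
record RealNumbers c ℓ₁ ℓ₂ : Set (lsuc (c ⊔ ℓ₁ ⊔ ℓ₂)) where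
  infix 4 _<_ _≤_
  field
    heytingField : HeytingField c ℓ₁ ℓ₂

  open HeytingField heytingField public

  field
    _<_                  : Rel Carrier ℓ₂
    isStrictPartialOrder : IsStrictPartialOrder _≈_ _<_
    #⇔<⊎>                : ∀ x y → (x # y) ⇔ (x < y ⊎ y < x)
    0<1                  : 0# < 1#
    +-monoˡ-<            : ∀ {x y} z → x < y → (x + z) < (y + z)
    *-pos                : ∀ {x y} → 0# < x → 0# < y → 0# < (x * y)

  _≤_ : Rel Carrier ℓ₂
  x ≤ y = ¬ (y < x)

  commutativeRing : CommutativeRing c ℓ₁
  commutativeRing = record { isCommutativeRing = isCommutativeRing }

  open CommutativeRing commutativeRing public using (semiring)
  open Semiring semiring public using (rawSemiring; +-rawMonoid)
  open RawSemiringDefs rawSemiring public using (_^_; sum)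
  open RawMonoidDefs +-rawMonoid public using () renaming (_×_ to _·_)

  IsCauchy : (ℕ → Carrier) → Set (c ⊔ ℓ₂)
  IsCauchy s = ∀ ε → 0# < ε →
    ∃[ N ] (∀ i j → N ℕ.≤ i → N ℕ.≤ j → (s i - s j) < ε)

  _ConvergesTo_ : (ℕ → Carrier) → Carrier → Set (c ⊔ ℓ₂)
  s ConvergesTo l = ∀ ε → 0# < ε →
    ∃[ N ] (∀ i → N ℕ.≤ i → (s i - l) < ε × (l - s i) < ε)

  field
    archimedean : ∀ x → ∃[ m ] (x < (m · 1#))
    complete    : ∀ s → IsCauchy s → ∃[ l ] (s ConvergesTo l)

module Spectral {c ℓ₁ ℓ₂} (ℝ : RealNumbers c ℓ₁ ℓ₂) where

  open RealNumbers ℝ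

  adjacency : ∀ {n} → Graph n → Fin n → Fin n → Carrier
  adjacency G u v = if does (edge? G u v) then 1# else 0#

  -- The adjacency eigenvalues λ₁ ≥ … ≥ λₙ, listed with multiplicity: the
  -- multiplicities are accounted for by a basis of ℝⁿ consisting of
  -- eigenvectors, vector j belonging to value j.  By the spectral theorem
  -- every graph has such a list, and the values are determined by the graph.
  record Eigenvalues {n} (G : Graph n) : Set (c ⊔ ℓ₁ ⊔ ℓ₂) where
    field
      value       : Vector Carrier n
      descending  : ∀ {i j} → i Fin.≤ j → value j ≤ value i
      vector      : Fin n → Vector Carrier n
      eigen       : ∀ j u →
        sum (λ v → adjacency G u v * vector j v) ≈ (value j * vector j u)
      independent : ∀ (a : Vector Carrier n) →
        (∀ u → sum (λ j → a j * vector j u) ≈ 0#) → ∀ j → a j ≈ 0#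
      spanning    : ∀ (x : Vector Carrier n) →
        Σ (Vector Carrier n) λ a → ∀ u → x u ≈ sum (λ j → a j * vector j u)

  S : ∀ {n} {G : Graph n} → ℕ → Eigenvalues G → Carrier
  S i Λ = sum (λ j → Eigenvalues.value Λ j ^ i)

  infix 4 _≺ₛ_

  -- Λ₁ and Λ₂ are the eigenvalues of G₁ and G₂; since the values are unique,
  -- it is immaterial which eigenvectors accompany them.
  _≺ₛ_ : ∀ {n} → Graph n → Graph n → Set (c ⊔ ℓ₁ ⊔ ℓ₂)
  _≺ₛ_ {n} G₁ G₂ = (Λ₁ : Eigenvalues G₁) (Λ₂ : Eigenvalues G₂) →
    ∃[ j ] (1 ℕ.≤ j × j ℕ.≤ n ∸ 1
           × (∀ i → i ℕ.< j → S i Λ₁ ≈ S i Λ₂)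
           × S j Λ₁ < S j Λ₂)

{-# OPTIONS --safe #-}

-- The moments S₀, …, S₄ already decide.  As S i is the trace of the i-th power
-- of the adjacency matrix, it counts closed walks of length i.  Deleting a
-- leaf attached at u removes one cut edge and lowers the closed walks of
-- length 2, 3, 4 by 2, 0 and 4 d(u) + 2, where d(u) is the degree of u without
-- the leaf.  Delete leaves as long as there are any: what remains is a graph of
-- minimum degree at least 2, which either has more edges than vertices, whence
-- S₂ is too large, or is a cycle.  In the second case S₂ and S₃ agree with those
-- of P n k, and S₄ is least when each leaf after the first is attached to the
-- leaf before it, which gives P n k.

module Submission where

open import Defs
open import Data.Nat using (ℕ; _+_; _≤_)
open import Data.Product using (_×_)
open import Relation.Nullary using (¬_)
open import Level using (Level)

open import Algebra.Bundles using (CommutativeRing)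
import Algebra.Properties.Ring
import Algebra.Properties.Semiring.Mult
import Algebra.Properties.Semiring.Sum
open import Data.Bool using (true; false; if_then_else_)
open import Data.Fin as Fin using (Fin; zero; suc; punchIn; punchOut; toℕ; fromℕ; fromℕ<)
open import Data.Fin.Permutation as Perm
  using (Permutation′; _⟨$⟩ʳ_; _⟨$⟩ˡ_; permutation; inverseˡ; inverseʳ)
import Data.Fin.Properties as Finₚ
open import Data.List
  using (List; []; _∷_; length; map; filter; cartesianProduct; allFin; tabulate)
import Data.List.Membership.DecPropositional as DecMembership
open import Data.List.Membership.Propositional using (_∈_)
open import Data.List.Membership.Propositional.Properties
  using (∈-map⁺; ∈-map⁻; ∈-filter⁺; ∈-filter⁻; ∈-cartesianProduct⁺; ∈-allFin)
open import Data.List.Membership.Propositional.Properties.WithK using (unique∧set⇒bag)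
open import Data.List.Properties using (length-map)
open import Data.List.Relation.Binary.BagAndSetEquality using (∼bag⇒↭)
open import Data.List.Relation.Binary.Permutation.Propositional.Properties using (↭-length)
open import Data.List.Relation.Unary.All as All using ([]; _∷_)
open import Data.List.Relation.Unary.AllPairs using ([]; _∷_)
open import Data.List.Relation.Unary.Any using (here; there)
import Data.List.Relation.Unary.Unique.Propositional.Properties as Uniqueₚ
open import Data.Nat as ℕ using (zero; suc; 2+; _∸_; s≤s; z≤n; s≤s⁻¹)
import Data.Nat.Properties as ℕₚ
open import Data.Nat.Tactic.RingSolver using (solve-∀)
open import Data.Product using (∃-syntax; Σ-syntax; _,_; proj₁; proj₂)
open import Data.Product.Properties using (≡-dec; ,-injective)
open import Data.Sum as Sum using (_⊎_; inj₁; inj₂)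
open import Data.Vec.Functional using (Vector)
open import Function using (_∘_; id)
open import Function.Bundles using (_⇔_; mk⇔; Equivalence)
open import Level using (0ℓ)
open import Relation.Binary.Construct.Closure.ReflexiveTransitive as Star
  using (Star; ε; _◅_; _◅◅_)
open import Relation.Binary.Construct.Closure.Symmetric using (SymClosure; fwd; bwd)
open import Relation.Binary.Core using (Rel)
open import Relation.Binary.Definitions using (tri<; tri≈; tri>)
open import Relation.Binary.PropositionalEquality as ≡
  using (_≡_; _≢_; cong; cong₂; subst; subst₂)
import Relation.Binary.Reasoning.Setoid
open import Relation.Binary.Structures using (IsStrictPartialOrder)
open import Relation.Nullary using (Dec; yes; no; does; contradiction)
open import Relation.Nullary.Decidable using (does-⇔; dec-true; dec-false)
open import Relation.Unary using (Decidable)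

-- Spectral moments as traces

-- Two obstacles shape the induction. The order looks only at moments up to n - 1, so S₄ may decide
-- only when n ≥ 5, that is, when k ≥ 2 is known. This works because the first leaf leaves no
-- choice: it is attached to a cycle, whose vertices are all equivalent. Only from the second leaf
-- on can two attachments differ. Hence `more-walks` carries `2 ≤ k`. The other obstacle is that a
-- cut edge need not hang on a leaf; it may join two cycles. Such edges are never located: when no
-- leaf is left but a cut edge remains, the graph cannot be 2-regular, because a cycle through an
-- edge gives a detour around it, and S₂ decides. That the end of the path is the best place for a
-- leaf rests on degrees. For k ≥ 1 it has degree 1, the least possible in a connected graph with at
-- least two vertices, and it is the only vertex of P n k with that degree. So attaching a leaf
-- there costs no more than any attachment in a rival graph, and strictly less than any other
-- attachment in P n k itself. All inequalities are settled between natural numbers; the real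
-- numbers, whose order is not assumed decidable, enter only at the end.

private
  module ℕΣ = Algebra.Properties.Semiring.Sum ℕₚ.+-*-semiring

-- Opaque, so that unification can read off the summand.
opaque
  ∑ : ∀ {n} → (Fin n → ℕ) → ℕ
  ∑ = ℕΣ.sum

  ∑-empty : (f : Fin 0 → ℕ) → ∑ f ≡ 0
  ∑-empty f = ≡.refl

  ∑-suc : ∀ {n} (f : Fin (suc n) → ℕ) → ∑ f ≡ f zero ℕ.+ ∑ (f ∘ suc)
  ∑-suc f = ≡.refl

  ∑-cong : ∀ {n} {f g : Fin n → ℕ} → (∀ x → f x ≡ g x) → ∑ f ≡ ∑ g
  ∑-cong {n} = ℕΣ.sum-cong-≗ {n}

  ∑-const : ∀ {n} m → ∑ {n} (λ _ → m) ≡ n ℕ.* m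
  ∑-const {zero} m = ≡.refl
  ∑-const {suc n} m = cong (m ℕ.+_) (∑-const {n} m)

  ∑-+ : ∀ {n} (f g : Fin n → ℕ) → ∑ (λ x → f x ℕ.+ g x) ≡ ∑ f ℕ.+ ∑ g
  ∑-+ = ℕΣ.∑-distrib-+

  ∑-punchIn : ∀ {n} (f : Fin (suc n) → ℕ) (v : Fin (suc n)) →
              ∑ f ≡ f v ℕ.+ ∑ (λ x → f (Fin.punchIn v x))
  ∑-punchIn f v = ℕΣ.sum-remove {i = v} f

  ∑-permute : ∀ {n} (f : Fin n → ℕ) (π : Permutation′ n) → ∑ f ≡ ∑ (λ x → f (π ⟨$⟩ʳ x))
  ∑-permute = ℕΣ.sum-permute

Matrix : ℕ → Set
Matrix n = Fin n → Fin n → ℕ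

trace : ∀ {n} → Matrix n → ℕ
trace M = ∑ λ u → M u u

infixl 7 _⊗_
_⊗_ : ∀ {n} → Matrix n → Matrix n → Matrix n
(M ⊗ N) u v = ∑ λ w → M u w ℕ.* N w v

δ : ∀ {n} → Matrix n
δ u v = if does (u Fin.≟ v) then 1 else 0

adj : ∀ {n} → Graph n → Matrix n
adj G u v = if does (edge? G u v) then 1 else 0

-- The fourth power is the square of `adj²`, so that the entries of `adj²` after attaching a leaf
-- serve for all three traces.
adj² adj³ adj⁴ : ∀ {n} → Graph n → Matrix n
adj² G = adj G ⊗ adj G
adj³ G = adj G ⊗ adj² G
adj⁴ G = adj² G ⊗ adj² G

∑-zero : ∀ {n} {f : Fin n → ℕ} → (∀ x → f x ≡ 0) → ∑ f ≡ 0
∑-zero {n} f≡0 = ≡.trans (∑-cong f≡0) (≡.trans (∑-const {n} 0) (ℕₚ.*-zeroʳ n))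

∑-δ : ∀ {n} (i : Fin n) (f : Fin n → ℕ) → ∑ (λ j → δ i j ℕ.* f j) ≡ f i
∑-δ zero f = ≡.trans (∑-suc _)
  (≡.trans (cong₂ ℕ._+_ (ℕₚ.*-identityˡ _) (∑-zero λ _ → ≡.refl)) (ℕₚ.+-identityʳ _))
∑-δ (suc i) f = ≡.trans (∑-suc _) (∑-δ i (f ∘ suc))

δ-sym : ∀ {n} (i j : Fin n) → δ i j ≡ δ j i
δ-sym zero zero = ≡.refl
δ-sym zero (suc j) = ≡.refl
δ-sym (suc i) zero = ≡.refl
δ-sym (suc i) (suc j) = δ-sym i j

δ-diag : ∀ {n} (i : Fin n) → δ i i ≡ 1
δ-diag zero = ≡.refl
δ-diag (suc i) = δ-diag i

module Moments {c ℓ₁ ℓ₂} (ℝ : RealNumbers c ℓ₁ ℓ₂) where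

  open RealNumbers ℝ using (commutativeRing; _<_; isStrictPartialOrder;
    0<1; +-monoˡ-<; _^_; _·_)
  open Spectral ℝ
  open CommutativeRing commutativeRing hiding (zero) renaming (_+_ to infixl 6 _⊕_)
  open Algebra.Properties.Semiring.Sum semiring
  open Algebra.Properties.Semiring.Mult semiring using (×-homo-+; ×1-homo-*)
  open Algebra.Properties.Ring ring using (-‿distribˡ-*; x+x≈x⇒x≈0; x∙y⁻¹≈ε⇒x≈y)
  open IsStrictPartialOrder isStrictPartialOrder using (<-resp-≈) renaming (trans to <-trans)
  open Relation.Binary.Reasoning.Setoid setoid

  ⟦_⟧ : ℕ → Carrier
  ⟦ m ⟧ = m · 1#

  ⟦⟧-< : ∀ {m n} → m ℕ.< n → ⟦ m ⟧ < ⟦ n ⟧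
  ⟦⟧-< {m} m<n = go (ℕₚ.≤⇒≤′ m<n)
    where
    step : ∀ n → ⟦ n ⟧ < ⟦ suc n ⟧
    step n = proj₂ <-resp-≈ (+-identityˡ ⟦ n ⟧) (+-monoˡ-< ⟦ n ⟧ 0<1)

    go : ∀ {n} → suc m ℕ.≤′ n → ⟦ m ⟧ < ⟦ n ⟧
    go ℕ.≤′-refl = step m
    go (ℕ.≤′-step {n} p) = <-trans (go p) (step n)

  ⟦∑⟧ : ∀ {n} (f : Fin n → ℕ) → ⟦ ∑ f ⟧ ≈ sum (λ x → ⟦ f x ⟧)
  ⟦∑⟧ {zero} f = reflexive (cong ⟦_⟧ (∑-empty f))
  ⟦∑⟧ {suc n} f = trans (reflexive (cong ⟦_⟧ (∑-suc f)))
    (trans (×-homo-+ 1# (f zero) (∑ (f ∘ suc))) (+-congˡ (⟦∑⟧ (f ∘ suc))))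

  ⟦if⟧ : ∀ b → (if b then 1# else 0#) ≈ ⟦ if b then 1 else 0 ⟧
  ⟦if⟧ true = sym (+-identityʳ 1#)
  ⟦if⟧ false = refl

  sum-δˡ : ∀ {n} (i : Fin n) (f : Fin n → Carrier) → sum (λ j → ⟦ δ i j ⟧ * f j) ≈ f i
  sum-δˡ {suc n} zero f = begin
    ⟦ 1 ⟧ * f zero ⊕ sum (λ j → 0# * f (suc j))
      ≈⟨ +-cong (*-congʳ (+-identityʳ 1#)) (sum-cong-≋ {n} λ j → zeroˡ (f (suc j))) ⟩
    1# * f zero ⊕ sum {n} (λ _ → 0#)
      ≈⟨ +-cong (*-identityˡ _) (sum-replicate-zero n) ⟩
    f zero ⊕ 0#  ≈⟨ +-identityʳ _ ⟩
    f zero       ∎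
  sum-δˡ (suc i) f = begin
    0# * f zero ⊕ sum (λ j → ⟦ δ i j ⟧ * f (suc j))
      ≈⟨ +-cong (zeroˡ _) (sum-δˡ i (f ∘ suc)) ⟩
    0# ⊕ f (suc i)  ≈⟨ +-identityˡ _ ⟩
    f (suc i)       ∎

  module _ {n} {G : Graph n} (Λ : Eigenvalues G) where
    open Eigenvalues Λ

    private
      sum-cong : {f g : Vector Carrier n} → (∀ x → f x ≈ g x) → sum f ≈ sum g
      sum-cong = sum-cong-≋ {n}

    -- The eigenvectors stay those of `G`, whatever `M` is: all powers of the adjacency matrix are
    -- diagonal in the one given basis.
    HasEigenvalues : Matrix n → Vector Carrier n → Set _
    HasEigenvalues M μ = ∀ j u → sum (λ v → ⟦ M u v ⟧ * vector j v) ≈ μ j * vector j u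

    δ-eigen : HasEigenvalues δ (λ _ → 1#)
    δ-eigen j u = trans (sum-δˡ u (vector j)) (sym (*-identityˡ _))

    adj-eigen : HasEigenvalues (adj G) value
    adj-eigen j u = trans
      (sum-cong λ v → *-congʳ (sym (⟦if⟧ (does (edge? G u v))))) (eigen j u)

    -- In coordinates, M (N x) = M (ν x) = ν (M x) = μ ν x for each basis vector x, after an
    -- exchange of two sums.
    ⊗-eigen : ∀ M N {μ ν} → HasEigenvalues M μ → HasEigenvalues N ν →
              HasEigenvalues (M ⊗ N) (λ j → μ j * ν j)
    ⊗-eigen M N {μ} {ν} Mμ Nν j u = begin
      sum (λ v → ⟦ (M ⊗ N) u v ⟧ * x v)
        ≈⟨ sum-cong (λ v → trans (*-congʳ (⟦∑⟧ (λ w → M u w ℕ.* N w v)))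
             (*-distribʳ-sum (x v) (λ w → ⟦ M u w ℕ.* N w v ⟧))) ⟩
      sum (λ v → sum (λ w → ⟦ M u w ℕ.* N w v ⟧ * x v))
        ≈⟨ ∑-comm (λ v w → ⟦ M u w ℕ.* N w v ⟧ * x v) ⟩
      sum (λ w → sum (λ v → ⟦ M u w ℕ.* N w v ⟧ * x v))
        ≈⟨ sum-cong (λ w → sum-cong (λ v → trans (*-congʳ (×1-homo-* (M u w) (N w v))) (*-assoc _ _ _))) ⟩
      sum (λ w → sum (λ v → ⟦ M u w ⟧ * (⟦ N w v ⟧ * x v)))
        ≈⟨ sum-cong (λ w → *-distribˡ-sum ⟦ M u w ⟧ (λ v → ⟦ N w v ⟧ * x v)) ⟨
      sum (λ w → ⟦ M u w ⟧ * sum (λ v → ⟦ N w v ⟧ * x v))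
        ≈⟨ sum-cong (λ w → trans (*-congˡ (Nν j w))
             (trans (sym (*-assoc _ _ _)) (trans (*-congʳ (*-comm _ _)) (*-assoc _ _ _)))) ⟩
      sum (λ w → ν j * (⟦ M u w ⟧ * x w))
        ≈⟨ *-distribˡ-sum (ν j) (λ w → ⟦ M u w ⟧ * x w) ⟨
      ν j * sum (λ w → ⟦ M u w ⟧ * x w)
        ≈⟨ *-congˡ (Mμ j u) ⟩
      ν j * (μ j * x u)
        ≈⟨ trans (sym (*-assoc _ _ _)) (*-congʳ (*-comm _ _)) ⟩
      (μ j * ν j) * x u ∎
      where x = vector j

    combination-injective : ∀ (a b : Vector Carrier n) →
      (∀ u → sum (λ j → a j * vector j u) ≈ sum (λ j → b j * vector j u)) → ∀ j → a j ≈ b j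
    combination-injective a b eq j =
      x∙y⁻¹≈ε⇒x≈y _ _ (independent (λ j → a j - b j) zero-combination j)
      where
      zero-combination : ∀ u → sum (λ j → (a j - b j) * vector j u) ≈ 0#
      zero-combination u = begin
        sum (λ j → (a j - b j) * vector j u)
          ≈⟨ sum-cong (λ j → trans (distribʳ _ _ _) (+-congˡ (trans (*-congʳ (-1*x≈-x _)) (*-assoc _ _ _)))) ⟩
        sum (λ j → a j * vector j u ⊕ - 1# * (b j * vector j u))
          ≈⟨ ∑-distrib-+ (λ j → a j * vector j u) (λ j → - 1# * (b j * vector j u)) ⟩
        sum (λ j → a j * vector j u) ⊕ sum (λ j → - 1# * (b j * vector j u))
          ≈⟨ +-cong (eq u) (sym (*-distribˡ-sum (- 1#) (λ j → b j * vector j u))) ⟩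
        sum (λ j → b j * vector j u) ⊕ - 1# * sum (λ j → b j * vector j u)
          ≈⟨ +-congˡ (sym (-1*x≈-x _)) ⟩
        sum (λ j → b j * vector j u) - sum (λ j → b j * vector j u)
          ≈⟨ -‿inverseʳ _ ⟩
        0# ∎
        where
        -1*x≈-x : ∀ x → - x ≈ - 1# * x
        -1*x≈-x x = trans (-‿cong (sym (*-identityˡ x))) (-‿distribˡ-* 1# x)

    private
      -- The coefficients of the `v`-th unit vector in the eigenbasis, that is, the `v`-th column of
      -- V⁻¹ when the eigenvectors are the columns of V.
      coordinate : Fin n → Vector Carrier n
      coordinate v = proj₁ (spanning (λ u → ⟦ δ v u ⟧))

      rightInverse : ∀ v u → ⟦ δ v u ⟧ ≈ sum (λ j → coordinate v j * vector j u)
      rightInverse v = proj₂ (spanning (λ u → ⟦ δ v u ⟧))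

      -- Spanning gives only V V⁻¹ = 1. For the other order, both sides, as families in `j`, are
      -- coefficients of the same vector `vector i`, so independence makes them equal.
      leftInverse : ∀ i j → sum (λ u → vector i u * coordinate u j) ≈ ⟦ δ i j ⟧
      leftInverse i = combination-injective _ _ λ w → begin
        sum (λ j → sum (λ u → vector i u * coordinate u j) * vector j w)
          ≈⟨ sum-cong (λ j → *-distribʳ-sum (vector j w) (λ u → vector i u * coordinate u j)) ⟩
        sum (λ j → sum (λ u → vector i u * coordinate u j * vector j w))
          ≈⟨ ∑-comm (λ j u → vector i u * coordinate u j * vector j w) ⟩
        sum (λ u → sum (λ j → vector i u * coordinate u j * vector j w))
          ≈⟨ sum-cong (λ u → trans (sum-cong λ j → *-assoc _ _ _)
               (sym (*-distribˡ-sum (vector i u) (λ j → coordinate u j * vector j w)))) ⟩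
        sum (λ u → vector i u * sum (λ j → coordinate u j * vector j w))
          ≈⟨ sum-cong (λ u → trans (*-congˡ (sym (rightInverse u w)))
               (trans (*-comm _ _) (*-congʳ (reflexive (cong ⟦_⟧ (δ-sym u w)))))) ⟩
        sum (λ u → ⟦ δ w u ⟧ * vector i u)
          ≈⟨ sum-δˡ w (vector i) ⟩
        vector i w
          ≈⟨ sum-δˡ i (λ j → vector j w) ⟨
        sum (λ j → ⟦ δ i j ⟧ * vector j w) ∎

    -- tr M = tr (V D V⁻¹) = tr D, where V has the eigenvectors as its columns.
    trace-eigen : ∀ M {μ} → HasEigenvalues M μ → sum μ ≈ ⟦ trace M ⟧
    trace-eigen M {μ} Mμ = begin
      sum μ
        ≈⟨ sum-cong (λ j → trans (*-congˡ (trans (leftInverse j j)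
             (trans (reflexive (cong ⟦_⟧ (δ-diag j))) (+-identityʳ 1#)))) (*-identityʳ _)) ⟨
      sum (λ j → μ j * sum (λ u → vector j u * coordinate u j))
        ≈⟨ sum-cong (λ j → trans (*-distribˡ-sum (μ j) (λ u → vector j u * coordinate u j))
             (sum-cong λ u → trans (sym (*-assoc _ _ _)) (*-congʳ (sym (Mμ j u))))) ⟩
      sum (λ j → sum (λ u → sum (λ v → ⟦ M u v ⟧ * vector j v) * coordinate u j))
        ≈⟨ ∑-comm (λ j u → sum (λ v → ⟦ M u v ⟧ * vector j v) * coordinate u j) ⟩
      sum (λ u → sum (λ j → sum (λ v → ⟦ M u v ⟧ * vector j v) * coordinate u j))
        ≈⟨ sum-cong (λ u → trans
             (sum-cong λ j → *-distribʳ-sum (coordinate u j) (λ v → ⟦ M u v ⟧ * vector j v))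
             (∑-comm (λ j v → ⟦ M u v ⟧ * vector j v * coordinate u j))) ⟩
      sum (λ u → sum (λ v → sum (λ j → ⟦ M u v ⟧ * vector j v * coordinate u j)))
        ≈⟨ sum-cong (λ u → sum-cong λ v → trans
             (sum-cong λ j → trans (*-assoc _ _ _) (*-congˡ (*-comm _ _)))
             (sym (*-distribˡ-sum ⟦ M u v ⟧ (λ j → coordinate u j * vector j v)))) ⟩
      sum (λ u → sum (λ v → ⟦ M u v ⟧ * sum (λ j → coordinate u j * vector j v)))
        ≈⟨ sum-cong (λ u → trans
             (sum-cong λ v → trans (*-congˡ (sym (rightInverse u v))) (*-comm _ _))
             (sum-δˡ u (λ v → ⟦ M u v ⟧))) ⟩
      sum (λ u → ⟦ M u u ⟧)
        ≈⟨ ⟦∑⟧ (λ u → M u u) ⟨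
      ⟦ trace M ⟧ ∎

    adj²-eigen : HasEigenvalues (adj² G) (λ j → value j * value j)
    adj²-eigen = ⊗-eigen (adj G) (adj G) adj-eigen adj-eigen

    S₀ : S 0 Λ ≈ ⟦ trace {n} δ ⟧
    S₀ = trace-eigen δ δ-eigen

    S₁ : S 1 Λ ≈ ⟦ trace (adj G) ⟧
    S₁ = trans (sum-cong λ j → *-identityʳ (value j)) (trace-eigen (adj G) adj-eigen)

    S₂ : S 2 Λ ≈ ⟦ trace (adj² G) ⟧
    S₂ = trans (sum-cong λ j → *-congˡ (*-identityʳ (value j)))
      (trace-eigen (adj² G) adj²-eigen)

    S₃ : S 3 Λ ≈ ⟦ trace (adj³ G) ⟧
    S₃ = trans (sum-cong λ j → *-congˡ (*-congˡ (*-identityʳ (value j))))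
      (trace-eigen (adj³ G) (⊗-eigen (adj G) (adj² G) adj-eigen adj²-eigen))

    S₄ : S 4 Λ ≈ ⟦ trace (adj⁴ G) ⟧
    S₄ = trans
      (sum-cong λ j → trans (*-congˡ (*-congˡ (*-congˡ (*-identityʳ (value j))))) (sym (*-assoc _ _ _)))
      (trace-eigen (adj⁴ G) (⊗-eigen (adj² G) (adj² G) adj²-eigen adj²-eigen))

-- Closed walks under isomorphism and under attaching a leaf

open import Data.Nat using (_*_; _<_)
open import Relation.Binary.PropositionalEquality using (refl; sym; trans; module ≡-Reasoning)
open Equivalence using (to; from)

indicator-cong : ∀ {A B : Set} → A ⇔ B → (a? : Dec A) (b? : Dec B) →
  (if does a? then 1 else 0) ≡ (if does b? then 1 else 0)
indicator-cong A⇔B a? b? = cong (if_then 1 else 0) (does-⇔ A⇔B a? b?)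

module _ {n} (G : Graph n) where

  deg : Fin n → ℕ
  deg u = ∑ (adj G u)

  adj-sym : ∀ u v → adj G u v ≡ adj G v u
  adj-sym u v = indicator-cong (mk⇔ (edge-sym G) (edge-sym G)) (edge? G u v) (edge? G v u)

  adj-edge : ∀ {u v} → Edge G u v → adj G u v ≡ 1
  adj-edge {u} {v} e = cong (if_then 1 else 0) (dec-true (edge? G u v) e)

  adj-nonEdge : ∀ {u v} → ¬ Edge G u v → adj G u v ≡ 0
  adj-nonEdge {u} {v} ¬e = cong (if_then 1 else 0) (dec-false (edge? G u v) ¬e)

  adj-irrefl : ∀ u → adj G u u ≡ 0
  adj-irrefl u = adj-nonEdge (edge-irrefl G refl)

  adj-idem : ∀ u v → adj G u v * adj G u v ≡ adj G u v
  adj-idem u v with does (edge? G u v)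
  ... | true = refl
  ... | false = refl

  adj²-diag : ∀ u → adj² G u u ≡ deg u
  adj²-diag u = ∑-cong λ v → trans (cong (adj G u v *_) (adj-sym v u)) (adj-idem u v)

  trace-adj : trace (adj G) ≡ 0
  trace-adj = ∑-zero adj-irrefl

  trace-adj² : trace (adj² G) ≡ ∑ deg
  trace-adj² = ∑-cong adj²-diag

-- Stated for relations and not for graphs, because it is also applied to what is left after
-- deleting an edge. `punchIn v` enumerates the vertices other than `v`, so the leaf may sit at any
-- position.
record LeafExtension {n} (R′ : Rel (Fin n) 0ℓ) (R : Rel (Fin (suc n)) 0ℓ)
                     (v : Fin (suc n)) (u : Fin n) : Set where
  field
    old    : ∀ x y → R (punchIn v x) (punchIn v y) ⇔ R′ x y
    leafˡ  : ∀ x → R v (punchIn v x) ⇔ u ≡ x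
    leafʳ  : ∀ x → R (punchIn v x) v ⇔ u ≡ x
    noLoop : ¬ R v v

module LeafCount {n} (G′ : Graph n) (G : Graph (suc n)) {v u}
  (ext : LeafExtension (Edge G′) (Edge G) v u) where

  open LeafExtension ext
  open ≡-Reasoning

  private
    p : Fin n → Fin (suc n)
    p = punchIn v

    B B² : Matrix n
    B = adj G′
    B² = adj² G′

    adj-vv : adj G v v ≡ 0
    adj-vv = adj-irrefl G v

    adj-vp : ∀ x → adj G v (p x) ≡ δ u x
    adj-vp x = indicator-cong (leafˡ x) (edge? G v (p x)) (u Fin.≟ x)

    adj-pv : ∀ x → adj G (p x) v ≡ δ u x
    adj-pv x = indicator-cong (leafʳ x) (edge? G (p x) v) (u Fin.≟ x)

    adj-pp : ∀ x y → adj G (p x) (p y) ≡ B x y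
    adj-pp x y = indicator-cong (old x y) (edge? G (p x) (p y)) (edge? G′ x y)

    -- With the leaf first and e the unit vector of `u`, the adjacency matrix has the blocks 0, eᵀ,
    -- e, B. Its square has the blocks 1, eᵀB, Be and eeᵀ + B², which the following four equations
    -- compute.
    adj²-vv : adj² G v v ≡ 1
    adj²-vv = begin
      adj² G v v                                        ≡⟨ ∑-punchIn _ v ⟩
      adj G v v * adj G v v + ∑ (λ x → adj G v (p x) * adj G (p x) v)
        ≡⟨ cong₂ _+_ (cong (_* adj G v v) adj-vv) (∑-cong λ x → cong₂ _*_ (adj-vp x) (adj-pv x)) ⟩
      ∑ (λ x → δ u x * δ u x)                           ≡⟨ ∑-δ u (δ u) ⟩
      δ u u                                             ≡⟨ δ-diag u ⟩
      1                                                 ∎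

    adj²-vp : ∀ y → adj² G v (p y) ≡ B u y
    adj²-vp y = begin
      adj² G v (p y)                                    ≡⟨ ∑-punchIn _ v ⟩
      adj G v v * adj G v (p y) + ∑ (λ x → adj G v (p x) * adj G (p x) (p y))
        ≡⟨ cong₂ _+_ (cong (_* adj G v (p y)) adj-vv) (∑-cong λ x → cong₂ _*_ (adj-vp x) (adj-pp x y)) ⟩
      ∑ (λ x → δ u x * B x y)                           ≡⟨ ∑-δ u (λ x → B x y) ⟩
      B u y                                             ∎

    adj²-pv : ∀ y → adj² G (p y) v ≡ B y u
    adj²-pv y = begin
      adj² G (p y) v                                    ≡⟨ ∑-punchIn _ v ⟩
      adj G (p y) v * adj G v v + ∑ (λ x → adj G (p y) (p x) * adj G (p x) v)
        ≡⟨ cong₂ _+_ (trans (cong (adj G (p y) v *_) adj-vv) (ℕₚ.*-zeroʳ (adj G (p y) v)))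
             (∑-cong λ x → trans (cong₂ _*_ (adj-pp y x) (adj-pv x)) (ℕₚ.*-comm (B y x) (δ u x))) ⟩
      ∑ (λ x → δ u x * B y x)                           ≡⟨ ∑-δ u (B y) ⟩
      B y u                                             ∎

    adj²-pp : ∀ x y → adj² G (p x) (p y) ≡ δ u x * δ u y + B² x y
    adj²-pp x y = trans (∑-punchIn _ v)
      (cong₂ _+_ (cong₂ _*_ (adj-pv x) (adj-vp y)) (∑-cong λ z → cong₂ _*_ (adj-pp x z) (adj-pp z y)))

  deg-leaf : deg G v ≡ 1
  deg-leaf = trans (sym (adj²-diag G v)) adj²-vv

  deg-old : ∀ x → deg G (p x) ≡ δ u x + deg G′ x
  deg-old x = trans (∑-punchIn _ v) (cong₂ _+_ (adj-pv x) (∑-cong (adj-pp x)))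

  trace-adj²-leaf : trace (adj² G) ≡ 2 + trace (adj² G′)
  trace-adj²-leaf = begin
    trace (adj² G)                                  ≡⟨ ∑-punchIn _ v ⟩
    adj² G v v + ∑ (λ x → adj² G (p x) (p x))       ≡⟨ cong₂ _+_ adj²-vv (∑-cong λ x → adj²-pp x x) ⟩
    1 + ∑ (λ x → δ u x * δ u x + B² x x)            ≡⟨ cong suc (∑-+ (λ x → δ u x * δ u x) (λ x → B² x x)) ⟩
    1 + (∑ (λ x → δ u x * δ u x) + trace B²)
      ≡⟨ cong (λ a → 1 + (a + trace B²)) (trans (∑-δ u (δ u)) (δ-diag u)) ⟩
    2 + trace B²                                    ∎

  -- A closed walk of length 3 traverses a triangle, and a leaf lies on none. In the computation
  -- every new term contains the diagonal entry `B u u`, which is 0.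
  trace-adj³-leaf : trace (adj³ G) ≡ trace (adj³ G′)
  trace-adj³-leaf = begin
    trace (adj³ G)                                  ≡⟨ ∑-punchIn _ v ⟩
    adj³ G v v + ∑ (λ x → adj³ G (p x) (p x))       ≡⟨ cong₂ _+_ leaf (∑-cong old′) ⟩
    ∑ (λ x → δ u x * (B u x + B x u) + adj³ G′ x x)
      ≡⟨ ∑-+ (λ x → δ u x * (B u x + B x u)) (λ x → adj³ G′ x x) ⟩
    ∑ (λ x → δ u x * (B u x + B x u)) + trace (adj³ G′)
      ≡⟨ cong (_+ trace (adj³ G′)) (trans (∑-δ u (λ x → B u x + B x u))
           (cong₂ _+_ (adj-irrefl G′ u) (adj-irrefl G′ u))) ⟩
    trace (adj³ G′)                                 ∎
    where
    leaf : adj³ G v v ≡ 0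
    leaf = begin
      adj³ G v v                                    ≡⟨ ∑-punchIn _ v ⟩
      adj G v v * adj² G v v + ∑ (λ x → adj G v (p x) * adj² G (p x) v)
        ≡⟨ cong₂ _+_ (cong (_* adj² G v v) adj-vv) (∑-cong λ x → cong₂ _*_ (adj-vp x) (adj²-pv x)) ⟩
      ∑ (λ x → δ u x * B x u)                       ≡⟨ ∑-δ u (λ x → B x u) ⟩
      B u u                                         ≡⟨ adj-irrefl G′ u ⟩
      0                                             ∎

    -- `expand` and `collect` bring the factors `δ u y` and `δ u x` to the front, the shape in which
    -- `∑-δ` collapses a sum.
    expand : ∀ b c d e → b * (c * d + e) ≡ c * (b * d) + b * e
    expand = solve-∀

    collect : ∀ c d e f → c * d + (e * c + f) ≡ c * (d + e) + f
    collect = solve-∀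

    old′ : ∀ x → adj³ G (p x) (p x) ≡ δ u x * (B u x + B x u) + adj³ G′ x x
    old′ x = begin
      adj³ G (p x) (p x)                            ≡⟨ ∑-punchIn _ v ⟩
      adj G (p x) v * adj² G v (p x) + ∑ (λ y → adj G (p x) (p y) * adj² G (p y) (p x))
        ≡⟨ cong₂ _+_ (cong₂ _*_ (adj-pv x) (adj²-vp x)) (∑-cong λ y →
             trans (cong₂ _*_ (adj-pp x y) (adj²-pp y x)) (expand (B x y) (δ u y) (δ u x) (B² y x))) ⟩
      δ u x * B u x + ∑ (λ y → δ u y * (B x y * δ u x) + B x y * B² y x)
        ≡⟨ cong (δ u x * B u x +_) (trans (∑-+ (λ y → δ u y * (B x y * δ u x)) (λ y → B x y * B² y x))
             (cong (_+ adj³ G′ x x) (∑-δ u (λ y → B x y * δ u x)))) ⟩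
      δ u x * B u x + (B x u * δ u x + adj³ G′ x x)
        ≡⟨ collect (δ u x) (B u x) (B x u) (adj³ G′ x x) ⟩
      δ u x * (B u x + B x u) + adj³ G′ x x         ∎

  -- In the square of the block matrix above, the leaf's entry is 1 + d. The old block contributes d
  -- through its mixed products and the trace of (eeᵀ + B²)², which is 1 + 2 d + tr B⁴.
  trace-adj⁴-leaf : trace (adj⁴ G) ≡ 2 + 4 * deg G′ u + trace (adj⁴ G′)
  trace-adj⁴-leaf = begin
    trace (adj⁴ G)                                  ≡⟨ ∑-punchIn _ v ⟩
    adj⁴ G v v + ∑ (λ x → adj⁴ G (p x) (p x))       ≡⟨ cong₂ _+_ leaf (∑-cong old′) ⟩
    1 + d + ∑ (λ x → B u x * B x u + (δ u x * f x + adj⁴ G′ x x))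
      ≡⟨ cong (1 + d +_) (trans (∑-+ (λ x → B u x * B x u) (λ x → δ u x * f x + adj⁴ G′ x x))
           (cong₂ _+_ (adj²-diag G′ u) (∑-+ (λ x → δ u x * f x) (λ x → adj⁴ G′ x x)))) ⟩
    1 + d + (d + (∑ (λ x → δ u x * f x) + trace (adj⁴ G′)))
      ≡⟨ cong (λ a → 1 + d + (d + (a + trace (adj⁴ G′)))) (trans (∑-δ u f)
           (cong₂ (λ a b → a * a + (b + b)) (δ-diag u) (adj²-diag G′ u))) ⟩
    1 + d + (d + (1 + (d + d) + trace (adj⁴ G′)))
      ≡⟨ total d (trace (adj⁴ G′)) ⟩
    2 + 4 * d + trace (adj⁴ G′)                     ∎
    where
    d = deg G′ u

    -- The cofactor of `δ u x` in the `x`-th diagonal entry; only its value 1 + 2 d at `u` survives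
    -- the summation.
    f : Fin n → ℕ
    f x = δ u u * δ u x + (B² u x + B² x u)

    total : ∀ d t → 1 + d + (d + (1 + (d + d) + t)) ≡ 2 + 4 * d + t
    total = solve-∀

    expand : ∀ a b c e → (a * b + c) * (b * a + e) ≡ b * (a * (b * a + e) + c * a) + c * e
    expand = solve-∀

    collect : ∀ b c a δuu e g t → b * c + (a * (δuu * a + e) + g * a + t) ≡ c * b + (a * (δuu * a + (e + g)) + t)
    collect = solve-∀

    leaf : adj⁴ G v v ≡ 1 + d
    leaf = begin
      adj⁴ G v v                                    ≡⟨ ∑-punchIn _ v ⟩
      adj² G v v * adj² G v v + ∑ (λ x → adj² G v (p x) * adj² G (p x) v)
        ≡⟨ cong₂ _+_ (cong₂ _*_ adj²-vv adj²-vv) (∑-cong λ x → cong₂ _*_ (adj²-vp x) (adj²-pv x)) ⟩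
      1 + adj² G′ u u                               ≡⟨ cong suc (adj²-diag G′ u) ⟩
      1 + d                                         ∎

    old′ : ∀ x → adj⁴ G (p x) (p x) ≡ B u x * B x u + (δ u x * f x + adj⁴ G′ x x)
    old′ x = begin
      adj⁴ G (p x) (p x)                            ≡⟨ ∑-punchIn _ v ⟩
      adj² G (p x) v * adj² G v (p x) + ∑ (λ y → adj² G (p x) (p y) * adj² G (p y) (p x))
        ≡⟨ cong₂ _+_ (cong₂ _*_ (adj²-pv x) (adj²-vp x)) (∑-cong λ y →
             trans (cong₂ _*_ (adj²-pp x y) (adj²-pp y x)) (expand (δ u x) (δ u y) (B² x y) (B² y x))) ⟩
      B x u * B u x + ∑ (λ y → δ u y * (δ u x * (δ u y * δ u x + B² y x) + B² x y * δ u x) + B² x y * B² y x)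
        ≡⟨ cong (B x u * B u x +_) (trans
             (∑-+ (λ y → δ u y * (δ u x * (δ u y * δ u x + B² y x) + B² x y * δ u x)) (λ y → B² x y * B² y x))
             (cong (_+ adj⁴ G′ x x) (∑-δ u (λ y → δ u x * (δ u y * δ u x + B² y x) + B² x y * δ u x)))) ⟩
      B x u * B u x + (δ u x * (δ u u * δ u x + B² u x) + B² x u * δ u x + adj⁴ G′ x x)
        ≡⟨ collect (B x u) (B u x) (δ u x) (δ u u) (B² u x) (B² x u) (adj⁴ G′ x x) ⟩
      B u x * B x u + (δ u x * f x + adj⁴ G′ x x)   ∎

module _ {n} {G H : Graph n} (iso : G ≅ H) where

  private
    π = proj₁ iso

    _∼_ : Matrix n → Matrix n → Set
    M ∼ M′ = ∀ u v → M u v ≡ M′ (π ⟨$⟩ʳ u) (π ⟨$⟩ʳ v)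

    adj-iso : adj G ∼ adj H
    adj-iso u v = indicator-cong (proj₂ iso u v) (edge? G u v) (edge? H _ _)

    ⊗-iso : ∀ M N M′ N′ → M ∼ M′ → N ∼ N′ → (M ⊗ N) ∼ (M′ ⊗ N′)
    ⊗-iso M N M′ N′ eM eN u v = trans (∑-cong λ w → cong₂ _*_ (eM u w) (eN w v))
      (sym (∑-permute (λ w → M′ _ w * N′ w _) π))

    trace-iso : ∀ M M′ → M ∼ M′ → trace M ≡ trace M′
    trace-iso M M′ eM = trans (∑-cong λ u → eM u u) (sym (∑-permute (λ u → M′ u u) π))

    adj²-iso : adj² G ∼ adj² H
    adj²-iso = ⊗-iso (adj G) (adj G) (adj H) (adj H) adj-iso adj-iso

  deg-iso : ∀ u → deg G u ≡ deg H (π ⟨$⟩ʳ u)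
  deg-iso u = trans (∑-cong (adj-iso u)) (sym (∑-permute (adj H _) π))

  trace-adj²-iso : trace (adj² G) ≡ trace (adj² H)
  trace-adj²-iso = trace-iso (adj² G) (adj² H) adj²-iso

  trace-adj³-iso : trace (adj³ G) ≡ trace (adj³ H)
  trace-adj³-iso = trace-iso (adj³ G) (adj³ H)
    (⊗-iso (adj G) (adj² G) (adj H) (adj² H) adj-iso adj²-iso)

  trace-adj⁴-iso : trace (adj⁴ G) ≡ trace (adj⁴ H)
  trace-adj⁴-iso = trace-iso (adj⁴ G) (adj⁴ H)
    (⊗-iso (adj² G) (adj² G) (adj² H) (adj² H) adj²-iso adj²-iso)

-- Cut edges under attaching a leaf

leaf-or-old : ∀ {n} (v z : Fin (suc n)) → (z ≡ v) ⊎ (∃[ x ] z ≡ punchIn v x)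
leaf-or-old v z with v Fin.≟ z
... | yes v≡z = inj₁ (sym v≡z)
... | no v≢z = inj₂ (punchOut v≢z , sym (Finₚ.punchIn-punchOut v≢z))

module LeafConnectivity {n} {R′ : Rel (Fin n) 0ℓ} {R : Rel (Fin (suc n)) 0ℓ} {v u}
  (ext : LeafExtension R′ R v u) where

  open LeafExtension ext

  private
    p : Fin n → Fin (suc n)
    p = punchIn v

    -- Collapsing the leaf onto its neighbour turns a step along the leaf edge into no step and
    -- keeps every other step. Hence paths in the larger graph project to the smaller one.
    retract : Fin (suc n) → Fin n
    retract z with leaf-or-old v z
    ... | inj₁ _ = u
    ... | inj₂ (x , _) = x

    retract-p : ∀ x → retract (p x) ≡ x
    retract-p x with leaf-or-old v (p x)
    ... | inj₁ px≡v = contradiction px≡v (Finₚ.punchInᵢ≢i v x)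
    ... | inj₂ (y , px≡py) = sym (Finₚ.punchIn-injective v x y px≡py)

    retract-step : ∀ {a b} → R a b → Star R′ (retract a) (retract b)
    retract-step {a} {b} r with leaf-or-old v a | leaf-or-old v b
    ... | inj₁ refl       | inj₁ refl       = contradiction r noLoop
    ... | inj₁ refl       | inj₂ (y , refl) with refl ← to (leafˡ y) r = ε
    ... | inj₂ (x , refl) | inj₁ refl       with refl ← to (leafʳ x) r = ε
    ... | inj₂ (x , refl) | inj₂ (y , refl) = to (old x y) r ◅ ε

    retract-star : ∀ {a b} → Star R a b → Star R′ (retract a) (retract b)
    retract-star ε = ε
    retract-star (r ◅ rs) = retract-step r ◅◅ retract-star rs

    to-retract : ∀ z → Star R z (p (retract z))
    to-retract z with leaf-or-old v z
    ... | inj₁ refl = from (leafˡ u) refl ◅ ε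
    ... | inj₂ (x , refl) = ε

    from-retract : ∀ z → Star R (p (retract z)) z
    from-retract z with leaf-or-old v z
    ... | inj₁ refl = from (leafʳ u) refl ◅ ε
    ... | inj₂ (x , refl) = ε

  star⁺ : ∀ {x y} → Star R′ x y → Star R (p x) (p y)
  star⁺ = Star.gmap p (from (old _ _))

  star⁻ : ∀ {x y} → Star R (p x) (p y) → Star R′ x y
  star⁻ {x} {y} s = subst₂ (Star R′) (retract-p x) (retract-p y) (retract-star s)

  connected⁻ : (∀ a b → Star R a b) → ∀ x y → Star R′ x y
  connected⁻ conn x y = star⁻ (conn (p x) (p y))

  twoComponents : TwoComponents R′ ⇔ TwoComponents R
  twoComponents = mk⇔ ⇒ ⇐
    where
    ⇒ : TwoComponents R′ → TwoComponents R
    ⇒ (x , y , ¬xy , cover) = p x , p y , ¬xy ∘ star⁻ , λ z →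
      Sum.map (λ s → star⁺ s ◅◅ from-retract z) (λ s → star⁺ s ◅◅ from-retract z) (cover (retract z))

    ⇐ : TwoComponents R → TwoComponents R′
    ⇐ (a , b , ¬ab , cover) = retract a , retract b
      , (λ s → ¬ab (to-retract a ◅◅ star⁺ s ◅◅ from-retract b))
      , λ z → Sum.map
          (λ s → subst (Star R′ _) (retract-p z) (retract-star s))
          (λ s → subst (Star R′ _) (retract-p z) (retract-star s)) (cover (p z))

module _ {n} {R Q : Rel (Fin n) 0ℓ} (R⇔Q : ∀ x y → R x y ⇔ Q x y) where

  twoComponents-cong : TwoComponents R → TwoComponents Q
  twoComponents-cong (x , y , ¬xy , cover) = x , y
    , ¬xy ∘ Star.map (λ {a} {b} → from (R⇔Q a b))
    , λ z → Sum.map (Star.map (λ {a} {b} → to (R⇔Q a b))) (Star.map (λ {a} {b} → to (R⇔Q a b))) (cover z)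

cutEdge-sym : ∀ {n} (G : Graph n) {u v} → CutEdge G u v → CutEdge G v u
cutEdge-sym G (e , two) = edge-sym G e
  , twoComponents-cong (λ _ _ → mk⇔ (λ (f , ¬uv) → f , ¬uv ∘ Sum.swap) (λ (f , ¬vu) → f , ¬vu ∘ Sum.swap)) two

-- Duplicate-free lists with the same members are permutations of each other, so the count does not
-- depend on the list.
HasCutEdges-unique : ∀ {n} (G : Graph n) {k l} → HasCutEdges G k → HasCutEdges G l → k ≡ l
HasCutEdges-unique G (es , es! , es⇔ , refl) (fs , fs! , fs⇔ , refl) =
  ↭-length (∼bag⇒↭ (unique∧set⇒bag es! fs! λ {(u , v)} →
    mk⇔ (λ e → from (fs⇔ u v) (to (es⇔ u v) e)) (λ f → from (es⇔ u v) (to (fs⇔ u v) f))))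

module LeafCutEdges {n} (G′ : Graph n) (G : Graph (suc n)) {v u}
  (ext : LeafExtension (Edge G′) (Edge G) v u) (conn : Connected G′) where

  open LeafExtension ext

  private
    p : Fin n → Fin (suc n)
    p = punchIn v

    p≢v : ∀ {x} → p x ≢ v
    p≢v {x} = Finₚ.punchInᵢ≢i v x

    p-inj : ∀ {x y} → p x ≡ p y → x ≡ y
    p-inj {x} {y} = Finₚ.punchIn-injective v x y

    p-< : ∀ x y → p x Fin.< p y ⇔ x Fin.< y
    p-< x y = mk⇔
      (λ px<py → ℕₚ.≰⇒> λ y≤x → ℕₚ.<⇒≱ px<py (Finₚ.punchIn-mono-≤ v y x y≤x))
      (λ x<y → ℕₚ.≰⇒> λ py≤px → ℕₚ.<⇒≱ x<y (Finₚ.punchIn-cancel-≤ v y x py≤px))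

    -- Deleting an old edge leaves the leaf where it was, so the comparison of components applies to
    -- the graphs without that edge.
    deleteEdge : ∀ x y → LeafExtension (DeleteEdge G′ x y) (DeleteEdge G (p x) (p y)) v u
    deleteEdge x y = record
      { old = λ a b → mk⇔
          (λ (e , ¬xy) → to (old a b) e , ¬xy ∘ Sum.map
            (λ (a≡x , b≡y) → cong p a≡x , cong p b≡y) (λ (a≡y , b≡x) → cong p a≡y , cong p b≡x))
          (λ (e , ¬xy) → from (old a b) e , ¬xy ∘ Sum.map
            (λ (a≡x , b≡y) → p-inj a≡x , p-inj b≡y) (λ (a≡y , b≡x) → p-inj a≡y , p-inj b≡x))
      ; leafˡ = λ a → mk⇔ (to (leafˡ a) ∘ proj₁) (λ u≡a → from (leafˡ a) u≡a ,
          λ { (inj₁ (v≡px , _)) → p≢v (sym v≡px) ; (inj₂ (v≡py , _)) → p≢v (sym v≡py) })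
      ; leafʳ = λ a → mk⇔ (to (leafʳ a) ∘ proj₁) (λ u≡a → from (leafʳ a) u≡a ,
          λ { (inj₁ (_ , v≡py)) → p≢v (sym v≡py) ; (inj₂ (_ , v≡px)) → p≢v (sym v≡px) })
      ; noLoop = noLoop ∘ proj₁
      }

  cutEdge-old : ∀ x y → CutEdge G′ x y ⇔ CutEdge G (p x) (p y)
  cutEdge-old x y = mk⇔
    (λ (e , two) → from (old x y) e , to twoComponents two)
    (λ (e , two) → to (old x y) e , from twoComponents two)
    where open LeafConnectivity (deleteEdge x y)

  cutEdge-leaf : CutEdge G v (p u)
  cutEdge-leaf = from (leafˡ u) refl , v , p u , isolated , cover
    where
    isolated : ¬ Star (DeleteEdge G v (p u)) v (p u)
    isolated s = escape s (p≢v ∘ sym)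
      where
      -- The only edge at the leaf has been deleted, so a walk from `v` cannot take its first step.
      escape : ∀ {z} → Star (DeleteEdge G v (p u)) v z → v ≢ z → _
      escape ε v≢v = v≢v refl
      escape (_◅_ {j = z} (e , ¬vu) _) _ with leaf-or-old v z
      ... | inj₁ refl = noLoop e
      ... | inj₂ (x , refl) with refl ← to (leafˡ x) e = ¬vu (inj₁ (refl , refl))

    cover : ∀ z → Star (DeleteEdge G v (p u)) v z ⊎ Star (DeleteEdge G v (p u)) (p u) z
    cover z with leaf-or-old v z
    ... | inj₁ refl = inj₁ ε
    ... | inj₂ (x , refl) = inj₂ (Star.gmap p
            (λ e → from (old _ _) e , λ { (inj₁ (p≡v , _)) → p≢v p≡v ; (inj₂ (_ , p≡v)) → p≢v p≡v })
            (conn u x))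

  hasCutEdges⁺ : ∀ {k} → HasCutEdges G′ k → HasCutEdges G (suc k)
  hasCutEdges⁺ (es , es! , es⇔ , refl) =
    e ∷ map pp es
      , All.tabulate e∉ ∷ Uniqueₚ.map⁺ pp-inj es!
      , (λ a b → mk⇔ (⇒ a b) (⇐ a b)) , cong suc (length-map pp es)
    where
    pp : Fin n × Fin n → Fin (suc n) × Fin (suc n)
    pp (x , y) = p x , p y

    pp-inj : ∀ {e f} → pp e ≡ pp f → e ≡ f
    pp-inj eq with eq₁ , eq₂ ← ,-injective eq = cong₂ _,_ (p-inj eq₁) (p-inj eq₂)

    -- Edges are listed with the smaller end first, and the leaf may come before or after its
    -- neighbour.
    leafEdge : ∃[ e ]
      (proj₁ e Fin.< proj₂ e × CutEdge G (proj₁ e) (proj₂ e)) × (e ≡ (v , p u) ⊎ e ≡ (p u , v))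
    leafEdge with Finₚ.<-cmp v (p u)
    ... | tri< v<pu _ _ = _ , (v<pu , cutEdge-leaf) , inj₁ refl
    ... | tri≈ _ v≡pu _ = contradiction (sym v≡pu) p≢v
    ... | tri> _ _ pu<v = _ , (pu<v , cutEdge-sym G cutEdge-leaf) , inj₂ refl

    e = proj₁ leafEdge
    e-cut = proj₁ (proj₂ leafEdge)
    e≡ = proj₂ (proj₂ leafEdge)

    e∉ : ∀ {f} → f ∈ map pp es → e ≢ f
    e∉ f∈ refl with ∈-map⁻ pp f∈
    ... | _ , _ , e≡pp with e≡
    ...   | inj₁ e≡vu = p≢v (proj₁ (,-injective (trans (sym e≡pp) e≡vu)))
    ...   | inj₂ e≡uv = p≢v (proj₂ (,-injective (trans (sym e≡pp) e≡uv)))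

    ⇒ : ∀ a b → (a , b) ∈ e ∷ map pp es → a Fin.< b × CutEdge G a b
    ⇒ a b (here refl) = e-cut
    ⇒ a b (there f∈) with ∈-map⁻ pp f∈
    ... | (x , y) , xy∈ , refl with x<y , cut ← to (es⇔ x y) xy∈ =
      from (p-< x y) x<y , to (cutEdge-old x y) cut

    ⇐ : ∀ a b → a Fin.< b × CutEdge G a b → (a , b) ∈ e ∷ map pp es
    ⇐ a b (a<b , cut) with leaf-or-old v a | leaf-or-old v b
    ... | inj₁ refl | inj₁ refl = contradiction (proj₁ cut) noLoop
    ... | inj₁ refl | inj₂ (y , refl) with refl ← to (leafˡ y) (proj₁ cut) | e≡
    ...   | inj₁ e≡vu = here (sym e≡vu)
    ...   | inj₂ e≡uv = contradiction
              (subst (λ e → proj₁ e Fin.< proj₂ e) e≡uv (proj₁ e-cut)) (ℕₚ.<-asym a<b)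
    ⇐ a b (a<b , cut) | inj₂ (x , refl) | inj₁ refl with refl ← to (leafʳ x) (proj₁ cut) | e≡
    ...   | inj₁ e≡vu = contradiction
              (subst (λ e → proj₁ e Fin.< proj₂ e) e≡vu (proj₁ e-cut)) (ℕₚ.<-asym a<b)
    ...   | inj₂ e≡uv = here (sym e≡uv)
    ⇐ a b (a<b , cut) | inj₂ (x , refl) | inj₂ (y , refl) =
      there (∈-map⁺ pp (from (es⇔ x y) (to (p-< x y) a<b , from (cutEdge-old x y) cut)))

  -- The cut edges of `G′` are found by testing which pairs of old vertices occur in the given list,
  -- since membership in a list is decidable. Adding the leaf edge back yields a second list for
  -- `G`, and uniqueness of the count gives k = 1 + l.
  hasCutEdges⁻ : ∀ {k} → HasCutEdges G k → ∃[ l ] (k ≡ suc l × HasCutEdges G′ l)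
  hasCutEdges⁻ has@(es , es! , es⇔ , refl) = length fs , HasCutEdges-unique G has (hasCutEdges⁺ has′) , has′
    where
    open DecMembership (≡-dec Fin._≟_ Fin._≟_) using (_∈?_)

    old? : (f : Fin n × Fin n) → Dec ((p (proj₁ f) , p (proj₂ f)) ∈ es)
    old? f = (p (proj₁ f) , p (proj₂ f)) ∈? es

    fs : List (Fin n × Fin n)
    fs = filter old? (cartesianProduct (allFin n) (allFin n))

    has′ : HasCutEdges G′ (length fs)
    has′ = fs
      , Uniqueₚ.filter⁺ old? (Uniqueₚ.cartesianProduct⁺ (Uniqueₚ.allFin⁺ n) (Uniqueₚ.allFin⁺ n))
      , (λ x y → mk⇔
          (λ f∈ → let px<py , cut = to (es⇔ (p x) (p y))
                                  (proj₂ (∈-filter⁻ old? {xs = cartesianProduct (allFin n) (allFin n)} f∈))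
                  in to (p-< x y) px<py , from (cutEdge-old x y) cut)
          (λ (x<y , cut) → ∈-filter⁺ old? (∈-cartesianProduct⁺ (∈-allFin x) (∈-allFin y))
            (from (es⇔ (p x) (p y)) (from (p-< x y) x<y , to (cutEdge-old x y) cut))))
      , refl

-- Connected 2-regular graphs are cycles

length-filter-tabulate : ∀ {n} {A : Set} {Q : A → Set} (Q? : Decidable Q) (g : Fin n → A) →
  length (filter Q? (tabulate g)) ≡ ∑ (λ x → if does (Q? (g x)) then 1 else 0)
length-filter-tabulate {zero} Q? g = sym (∑-empty _)
length-filter-tabulate {suc n} Q? g with does (Q? (g zero)) | ∑-suc (λ x → if does (Q? (g x)) then 1 else 0)
... | true  | eq = trans (cong suc (length-filter-tabulate Q? (g ∘ suc))) (sym eq)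
... | false | eq = trans (length-filter-tabulate Q? (g ∘ suc)) (sym eq)

module _ {n} (G : Graph n) where

  -- A degree given as a sum cannot be taken apart; given as the length of this duplicate-free list,
  -- degree 1 or 2 names the neighbours.
  neighbours : Fin n → List (Fin n)
  neighbours u = filter (edge? G u) (allFin n)

  length-neighbours : ∀ u → length (neighbours u) ≡ deg G u
  length-neighbours u = length-filter-tabulate (edge? G u) id

  ∈-neighbours : ∀ u x → x ∈ neighbours u ⇔ Edge G u x
  ∈-neighbours u x = mk⇔
    (λ x∈ → proj₂ (∈-filter⁻ (edge? G u) {xs = allFin n} x∈))
    (∈-filter⁺ (edge? G u) (∈-allFin x))

  deg-pos : ∀ {u x} → Edge G u x → 0 < deg G u
  deg-pos {u} {x} e with neighbours u | length-neighbours u | from (∈-neighbours u x) e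
  ... | _ ∷ _ | eq | _ = subst (0 <_) eq (s≤s z≤n)

  deg-pos⁻ : ∀ {u} → 0 < deg G u → ∃[ x ] Edge G u x
  deg-pos⁻ {u} pos with neighbours u | subst (0 <_) (sym (length-neighbours u)) pos | ∈-neighbours u
  ... | x ∷ _ | _ | nbr = x , to (nbr x) (here refl)

  deg-one : ∀ {u} → deg G u ≡ 1 → ∃[ w ] (∀ x → Edge G u x ⇔ w ≡ x)
  deg-one {u} d with neighbours u | trans (length-neighbours u) d | ∈-neighbours u
  ... | w ∷ [] | refl | nbr = w , λ x → mk⇔
    (λ e → case-one (from (nbr x) e)) (λ { refl → to (nbr w) (here refl) })
    where
    case-one : ∀ {x} → x ∈ w ∷ [] → w ≡ x
    case-one (here eq) = sym eq

  -- The rule for continuing a walk: having entered `u` from `x`, leave through the other neighbour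
  -- `y`.
  deg-two : ∀ {u x} → deg G u ≡ 2 → Edge G u x →
    ∃[ y ] (y ≢ x × Edge G u y × (∀ z → Edge G u z → z ≡ x ⊎ z ≡ y))
  deg-two {u} {x} d e
    with neighbours u | trans (length-neighbours u) d | ∈-neighbours u
       | Uniqueₚ.filter⁺ (edge? G u) (Uniqueₚ.allFin⁺ n)
  ... | p ∷ q ∷ [] | refl | nbr | (p≢q ∷ []) ∷ _ with from (nbr x) e
  ...   | here refl = q , p≢q ∘ sym , to (nbr q) (there (here refl)) , λ z f → case (from (nbr z) f)
    where
    case : ∀ {z} → z ∈ p ∷ q ∷ [] → z ≡ p ⊎ z ≡ q
    case (here eq) = inj₁ eq
    case (there (here eq)) = inj₂ eq
  ...   | there (here refl) = p , p≢q , to (nbr p) (here refl) , λ z f → case (from (nbr z) f)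
    where
    case : ∀ {z} → z ∈ p ∷ q ∷ [] → z ≡ q ⊎ z ≡ p
    case (here eq) = inj₂ eq
    case (there (here eq)) = inj₁ eq

  two-neighbours : ∀ {u p q} → p ≢ q → (∀ x → Edge G u x ⇔ (p ≡ x ⊎ q ≡ x)) → deg G u ≡ 2
  two-neighbours {u} {p} {q} p≢q nbr = trans (∑-cong split)
    (trans (∑-+ (λ x → δ p x * 1) (λ x → δ q x * 1))
    (cong₂ _+_ (∑-δ p (λ _ → 1)) (∑-δ q (λ _ → 1))))
    where
    split : ∀ x → adj G u x ≡ δ p x * 1 + δ q x * 1
    split x with p Fin.≟ x | q Fin.≟ x
    ... | yes refl | yes refl = contradiction refl p≢q
    ... | yes refl | no _ = adj-edge G (from (nbr x) (inj₁ refl))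
    ... | no _ | yes refl = adj-edge G (from (nbr x) (inj₂ refl))
    ... | no p≢x | no q≢x = adj-nonEdge G λ e → Sum.[ p≢x , q≢x ] (to (nbr x) e)

-- In a connected graph, nbr-0 and nbr-suc force the cycle through every vertex.
record HamiltonCycle {n} (G : Graph n) (a b : Fin n) : Set where
  field
    m         : ℕ
    2≤m       : 2 ≤ m
    f         : ℕ → Fin n
    start     : f 0 ≡ a
    end       : f m ≡ b
    step      : ∀ i → Edge G (f i) (f (suc i))
    close     : f (suc m) ≡ f 0
    injective : ∀ {i j} → i ≤ m → j ≤ m → f i ≡ f j → i ≡ j
    nbr-0     : ∀ {z} → Edge G (f 0) z → z ≡ f m ⊎ z ≡ f 1
    nbr-suc   : ∀ i {z} → Edge G (f (suc i)) z → z ≡ f i ⊎ z ≡ f (2 + i)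

module Walk {n} (G : Graph n) (regular : ∀ u → deg G u ≡ 2) {a b : Fin n} (ba : Edge G b a) where

  private
    Dart : Set
    Dart = Σ[ u ∈ Fin n ] Σ[ v ∈ Fin n ] Edge G u v

    -- Remembering the directed edge, and not just the vertex, is what keeps the walk from turning
    -- back.
    next : Dart → Dart
    next (u , v , uv) = let w , _ , vw , _ = deg-two G (regular v) (edge-sym G uv) in v , w , vw

    dart : ℕ → Dart
    dart zero = b , a , ba
    dart (suc i) = next (dart i)

    w : ℕ → Fin n
    w i = proj₁ (dart i)

    w-step : ∀ i → Edge G (w i) (w (suc i))
    w-step i = proj₂ (proj₂ (dart i))

    w-turn : ∀ i → w (2 + i) ≢ w i
    w-turn i = let u , v , uv = dart i in proj₁ (proj₂ (deg-two G (regular v) (edge-sym G uv)))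

    w-nbr : ∀ i {z} → Edge G (w (suc i)) z → z ≡ w i ⊎ z ≡ w (2 + i)
    w-nbr i = let u , v , uv = dart i in proj₂ (proj₂ (proj₂ (deg-two G (regular v) (edge-sym G uv)))) _

    Distinct : ℕ → Set
    Distinct m = ∀ {i j} → i < j → j ≤ m → w i ≢ w j

    -- The first vertex to be repeated is `w 0`. If `w (2 + m)` were `w (suc i)`, its predecessor
    -- `w (suc m)` would be a neighbour of `w (suc i)`, hence `w i` or `w (2 + i)`. This is an
    -- earlier repetition, a loop or a turn back.
    extend : ∀ m → Distinct (suc m) → w (2 + m) ≢ w 0 → Distinct (2 + m)
    extend m distinct open-ended {i} {j} i<j j≤ wi≡wj with ℕₚ.m≤n⇒m<n∨m≡n j≤
    ... | inj₁ j< = distinct i<j (s≤s⁻¹ j<) wi≡wj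
    extend m distinct open-ended {zero} i<j j≤ wi≡wj | inj₂ refl = open-ended (sym wi≡wj)
    extend m distinct open-ended {suc i} i<j j≤ wi≡wj | inj₂ refl
      with w-nbr i (subst (λ x → Edge G x (w (suc m))) (sym wi≡wj) (edge-sym G (w-step (suc m))))
    ... | inj₁ wm≡ = distinct (s≤s⁻¹ i<j) ℕₚ.≤-refl (sym wm≡)
    ... | inj₂ wm≡ with ℕₚ.<-cmp i m
    ...   | tri> _ _ m<i = contradiction (s≤s⁻¹ (s≤s⁻¹ i<j)) (ℕₚ.<⇒≱ m<i)
    ...   | tri≈ _ refl _ = edge-irrefl G wm≡ (w-step (suc m))
    ...   | tri< i<m _ _ with ℕₚ.m≤n⇒m<n∨m≡n i<m
    ...     | inj₁ 1+i<m = distinct (s≤s 1+i<m) ℕₚ.≤-refl (sym wm≡)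
    -- Here 2 + i = 1 + m, so `wm≡` says nothing; but the supposed repetition is itself a turn back
    -- to `w m`.
    ...     | inj₂ refl = w-turn (suc i) (sym wi≡wj)

    distinct⇒≤ : ∀ m → Distinct m → suc m ≤ n
    distinct⇒≤ m distinct = Finₚ.injective⇒≤ {f = w ∘ toℕ} inj
      where
      inj : ∀ {i j : Fin (suc m)} → w (toℕ i) ≡ w (toℕ j) → i ≡ j
      inj {i} {j} eq with ℕₚ.<-cmp (toℕ i) (toℕ j)
      ... | tri< i<j _ _ = contradiction eq (distinct i<j (s≤s⁻¹ (Finₚ.toℕ<n j)))
      ... | tri≈ _ i≡j _ = Finₚ.toℕ-injective i≡j
      ... | tri> _ _ j<i = contradiction (sym eq) (distinct j<i (s≤s⁻¹ (Finₚ.toℕ<n i)))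

    -- Distinctness up to index m + 1 needs m + 2 ≤ n, whereas exhausted fuel would mean n ≤ m.
    closing : ∀ fuel m → n ≤ m + fuel → Distinct (suc m) → ∃[ m′ ] (Distinct (suc m′) × w (2 + m′) ≡ w 0)
    closing zero m n≤m distinct = contradiction
      (ℕₚ.≤-trans (ℕₚ.m≤n+m (suc m) 1) (distinct⇒≤ (suc m) distinct))
      (ℕₚ.≤⇒≯ (subst (n ≤_) (ℕₚ.+-identityʳ m) n≤m))
    closing (suc fuel) m n≤ distinct with w (2 + m) Fin.≟ w 0
    ... | yes eq = m , distinct , eq
    ... | no ¬eq = closing fuel (suc m) (subst (n ≤_) (ℕₚ.+-suc m fuel) n≤) (extend m distinct ¬eq)

    distinct-1 : Distinct 1
    distinct-1 {zero} {suc zero} i<j j≤1 eq = edge-irrefl G eq ba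
    distinct-1 {suc i} {suc zero} (s≤s ()) j≤1 eq
    distinct-1 {i} {suc (suc j)} i<j (s≤s ()) eq

  hamiltonCycle : HamiltonCycle G a b
  hamiltonCycle with closing n 0 ℕₚ.≤-refl distinct-1
  -- A return after two steps would be a turn back, so the cycle has at least three vertices.
  ... | zero , _ , eq = contradiction eq (w-turn 0)
  ... | suc m , distinct , eq = record
    { m = 2 + m
    ; 2≤m = s≤s (s≤s z≤n)
    -- The walk starts with `b`, `a`; shifting by one makes `a` the start and the return to `b` the
    -- end.
    ; f = w ∘ suc
    ; start = refl
    ; end = eq
    ; step = λ i → w-step (suc i)
    -- As a neighbour of `b`, `a` is the vertex before or after the return to `b`, and distinctness
    -- excludes the former.
    ; close = Sum.[ (λ a≡ → contradiction a≡ (distinct (s≤s (s≤s z≤n)) ℕₚ.≤-refl)) , sym ]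
        (w-nbr (2 + m) (subst (λ x → Edge G x a) (sym eq) ba))
    ; injective = λ {i} {j} i≤m j≤m wi≡wj → case (ℕₚ.<-cmp i j) i≤m j≤m wi≡wj
    ; nbr-0 = λ e → Sum.map₁ (λ z≡b → trans z≡b (sym eq)) (w-nbr 0 e)
    ; nbr-suc = λ i → w-nbr (suc i)
    }
    where
    lt : ∀ {i j} → i < j → j ≤ 2 + m → w (suc i) ≢ w (suc j)
    lt {i} {j} i<j j≤m wi≡wj with ℕₚ.m≤n⇒m<n∨m≡n j≤m
    ... | inj₁ j<m = distinct (s≤s i<j) j<m wi≡wj
    ... | inj₂ refl = distinct (s≤s z≤n) i<j (sym (trans wi≡wj eq))

    case : ∀ {i j} → _ → i ≤ 2 + m → j ≤ 2 + m → w (suc i) ≡ w (suc j) → i ≡ j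
    case (tri< i<j _ _) i≤m j≤m eq = contradiction eq (lt i<j j≤m)
    case (tri≈ _ i≡j _) i≤m j≤m eq = i≡j
    case (tri> _ _ j<i) i≤m j≤m eq = contradiction (sym eq) (lt j<i i≤m)

module CycleProperties {n} {G : Graph n} {a b} (H : HamiltonCycle G a b) where

  open HamiltonCycle H

  -- The rest of the cycle leads from `a` to `b`, so every use of the edge between them can be
  -- rerouted.
  ¬cutEdge : Connected G → ¬ CutEdge G a b
  ¬cutEdge conn (_ , x , y , ¬xy , _) = ¬xy (bypass-star (conn x y))
    where
    R = DeleteEdge G a b

    f-step : ∀ {i} → i < m → R (f i) (f (suc i))
    f-step {i} i<m = step i , λ
      -- Such a step would give i = 0 and m = 1: the cycle would degenerate to the deleted edge.
      { (inj₁ (fi≡a , fi′≡b)) → ℕₚ.<⇒≢ 2≤m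
          (trans (cong suc (sym (injective (ℕₚ.<⇒≤ i<m) z≤n (trans fi≡a (sym start)))))
                 (injective i<m ℕₚ.≤-refl (trans fi′≡b (sym end))))
      ; (inj₂ (fi≡b , _)) → ℕₚ.<⇒≢ i<m (injective (ℕₚ.<⇒≤ i<m) ℕₚ.≤-refl (trans fi≡b (sym end))) }

    path : ∀ i → i ≤ m → Star R (f 0) (f i)
    path zero _ = ε
    path (suc i) i<m = path i (ℕₚ.<⇒≤ i<m) ◅◅ f-step i<m ◅ ε

    R-sym : ∀ {x y} → R x y → R y x
    R-sym (e , ¬ab) = edge-sym G e , ¬ab ∘ λ
      { (inj₁ (y≡a , x≡b)) → inj₂ (x≡b , y≡a) ; (inj₂ (y≡b , x≡a)) → inj₁ (x≡a , y≡b) }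

    a⇝b : Star R a b
    a⇝b = subst₂ (Star R) start end (path m ℕₚ.≤-refl)

    bypass : ∀ {x y} → Edge G x y → Star R x y
    bypass {x} {y} e with x Fin.≟ a | y Fin.≟ b | x Fin.≟ b | y Fin.≟ a
    ... | yes refl | yes refl | _ | _ = a⇝b
    ... | _ | _ | yes refl | yes refl = Star.reverse R-sym a⇝b
    ... | no x≢a | _ | no x≢b | _ = (e , Sum.[ x≢a ∘ proj₁ , x≢b ∘ proj₁ ]) ◅ ε
    ... | no x≢a | _ | _ | no y≢a = (e , Sum.[ x≢a ∘ proj₁ , y≢a ∘ proj₂ ]) ◅ ε
    ... | _ | no y≢b | no x≢b | _ = (e , Sum.[ y≢b ∘ proj₂ , x≢b ∘ proj₁ ]) ◅ ε
    ... | _ | no y≢b | _ | no y≢a = (e , Sum.[ y≢b ∘ proj₂ , y≢a ∘ proj₂ ]) ◅ ε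

    bypass-star : ∀ {x y} → Star (Edge G) x y → Star R x y
    bypass-star ε = ε
    bypass-star (e ◅ s) = bypass e ◅◅ bypass-star s

≅-trans : ∀ {n} {G H K : Graph n} → G ≅ H → H ≅ K → G ≅ K
≅-trans (π , iso) (ρ , iso′) = π Perm.∘ₚ ρ , λ u v →
  mk⇔ (to (iso′ _ _) ∘ to (iso u v)) (from (iso u v) ∘ from (iso′ _ _))

module _ {n} {G : Graph n} {a b} (H : HamiltonCycle G a b) (conn : Connected G) where

  open HamiltonCycle H

  private
    Reached : Fin n → Set
    Reached z = ∃[ i ] (i ≤ m × f i ≡ z)

    reached-next : ∀ {y z} → Reached y → Edge G y z → Reached z
    reached-next (zero , _ , refl) e with nbr-0 e
    ... | inj₁ refl = m , ℕₚ.≤-refl , refl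
    ... | inj₂ refl = 1 , ℕₚ.<⇒≤ 2≤m , refl
    reached-next (suc i , i<m , refl) e with nbr-suc i e
    ... | inj₁ refl = i , ℕₚ.<⇒≤ i<m , refl
    ... | inj₂ refl with ℕₚ.m≤n⇒m<n∨m≡n i<m
    ...   | inj₁ 1+i<m = 2 + i , 1+i<m , refl
    ...   | inj₂ refl = 0 , z≤n , sym close

    reached-star : ∀ {y z} → Reached y → Star (Edge G) y z → Reached z
    reached-star r ε = r
    reached-star r (e ◅ s) = reached-star (reached-next r e) s

    reached : ∀ z → Reached z
    reached z = reached-star (0 , z≤n , refl) (conn (f 0) z)

    index : Fin n → ℕ
    index = proj₁ ∘ reached

    index≤m : ∀ z → index z ≤ m
    index≤m = proj₁ ∘ proj₂ ∘ reached

    f-index : ∀ z → f (index z) ≡ z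
    f-index = proj₂ ∘ proj₂ ∘ reached

    index-f : ∀ {i} → i ≤ m → index (f i) ≡ i
    index-f i≤m = injective (index≤m _) i≤m (f-index _)

  1+m≡n : suc m ≡ n
  1+m≡n = ℕₚ.≤-antisym
    (Finₚ.injective⇒≤ {f = λ (i : Fin (suc m)) → f (toℕ i)} λ {i} {j} eq →
      Finₚ.toℕ-injective (injective (s≤s⁻¹ (Finₚ.toℕ<n i)) (s≤s⁻¹ (Finₚ.toℕ<n j)) eq))
    (Finₚ.injective⇒≤ {f = λ z → fromℕ< (s≤s (index≤m z))} λ {y} {z} eq →
      trans (sym (f-index y)) (trans (cong f
        (Finₚ.fromℕ<-injective _ _ (s≤s (index≤m y)) (s≤s (index≤m z)) eq)) (f-index z)))

  private
    index<n : ∀ z → index z < n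
    index<n z = subst (index z <_) 1+m≡n (s≤s (index≤m z))

    toℕ≤m : ∀ (i : Fin n) → toℕ i ≤ m
    toℕ≤m i = s≤s⁻¹ (subst (toℕ i <_) (sym 1+m≡n) (Finₚ.toℕ<n i))

    position : Permutation′ n
    position = permutation (λ z → fromℕ< (index<n z)) (f ∘ toℕ)
      (λ i → Finₚ.toℕ-injective (trans (Finₚ.toℕ-fromℕ< _) (index-f (toℕ≤m i))))
      (λ z → trans (cong f (Finₚ.toℕ-fromℕ< _)) (f-index z))

    toℕ-position : ∀ z → toℕ (position ⟨$⟩ʳ z) ≡ index z
    toℕ-position z = Finₚ.toℕ-fromℕ< (index<n z)

  module _ (h : 3 ≤ n) where

    private
      arc⇒edge : ∀ u v → Arc n 0 (position ⟨$⟩ʳ u) (position ⟨$⟩ʳ v) → Edge G u v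
      arc⇒edge u v (inj₁ consecutive) = subst₂ (Edge G) (f-index u)
        (trans (cong f (trans (cong suc (sym (toℕ-position u)))
          (trans (sym consecutive) (toℕ-position v)))) (f-index v))
        (step (index u))
      arc⇒edge u v (inj₂ (first , last)) = subst₂ (Edge G)
        (trans close (trans (cong f (sym (trans (sym (toℕ-position u)) first))) (f-index u)))
        (trans (cong f (ℕₚ.suc-injective (trans 1+m≡n (trans (sym last) (cong suc (toℕ-position v)))))) (f-index v))
        (edge-sym G (step m))

      steps⇒arcs : ∀ u v i j → i ≤ m → j ≤ m → index u ≡ i → index v ≡ j → Edge G (f i) (f j) →
                   SymClosure (Arc n 0) (position ⟨$⟩ʳ u) (position ⟨$⟩ʳ v)
      steps⇒arcs u v zero j i≤m j≤m equ eqv e with nbr-0 e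
      ... | inj₁ fj≡fm = fwd (inj₂ (trans (toℕ-position u) equ ,
              trans (cong suc (trans (toℕ-position v) (trans eqv (injective j≤m ℕₚ.≤-refl fj≡fm)))) 1+m≡n))
      ... | inj₂ fj≡f1 = fwd (inj₁ (trans (toℕ-position v)
              (trans eqv (trans (injective j≤m (ℕₚ.<⇒≤ 2≤m) fj≡f1) (cong suc (sym (trans (toℕ-position u) equ)))))))
      steps⇒arcs u v (suc i) j i<m j≤m equ eqv e with nbr-suc i e
      ... | inj₁ fj≡fi = bwd (inj₁ (trans (toℕ-position u)
              (trans equ (cong suc (sym (trans (toℕ-position v) (trans eqv (injective j≤m (ℕₚ.<⇒≤ i<m) fj≡fi))))))))
      ... | inj₂ fj≡f with ℕₚ.m≤n⇒m<n∨m≡n i<m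
      ...   | inj₁ 1+i<m = fwd (inj₁ (trans (toℕ-position v)
                (trans eqv (trans (injective j≤m 1+i<m fj≡f) (cong suc (sym (trans (toℕ-position u) equ)))))))
      ...   | inj₂ refl = bwd (inj₂ (trans (toℕ-position v) (trans eqv (injective j≤m z≤n (trans fj≡f close))) ,
                trans (cong suc (trans (toℕ-position u) equ)) 1+m≡n))

      edge⇔ : ∀ u v → Edge G u v ⇔ Edge (P n 0 h) (position ⟨$⟩ʳ u) (position ⟨$⟩ʳ v)
      edge⇔ u v = mk⇔
        (λ e → steps⇒arcs u v (index u) (index v) (index≤m u) (index≤m v) refl refl
          (subst₂ (Edge G) (sym (f-index u)) (sym (f-index v)) e))
        λ { (fwd arc) → arc⇒edge u v arc ; (bwd arc) → edge-sym G (arc⇒edge v u arc) }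

    cycle-iso : Σ[ iso ∈ G ≅ P n 0 h ] suc (toℕ (proj₁ iso ⟨$⟩ʳ b)) ≡ n
    cycle-iso = (position , edge⇔) ,
      trans (cong suc (trans (toℕ-position b) (trans (cong index (sym end)) (index-f ℕₚ.≤-refl)))) 1+m≡n

-- Comparison with P n k

connected⇒0<deg : ∀ {n} (G : Graph (suc n)) → Connected G → 1 ≤ n → ∀ u → 0 < deg G u
connected⇒0<deg G conn (s≤s _) u = first-step (conn u (punchIn u zero)) (Finₚ.punchInᵢ≢i u zero ∘ sym)
  where
  first-step : ∀ {x} → Star (Edge G) u x → u ≢ x → 0 < deg G u
  first-step ε u≢u = contradiction refl u≢u
  first-step (e ◅ _) _ = deg-pos G e

remove : ∀ {n} → Graph (suc n) → Fin (suc n) → Graph n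
remove G v = record
  { Edge = λ x y → Edge G (punchIn v x) (punchIn v y)
  ; edge? = λ x y → edge? G (punchIn v x) (punchIn v y)
  ; edge-sym = edge-sym G
  ; edge-irrefl = λ { refl → edge-irrefl G refl }
  }

remove-leaf : ∀ {n} (G : Graph (suc n)) {v} → deg G v ≡ 1 →
              ∃[ u ] LeafExtension (Edge (remove G v)) (Edge G) v u
remove-leaf G {v} d with w , nbr ← deg-one G d with leaf-or-old v w
... | inj₁ refl = contradiction (from (nbr v) refl) (edge-irrefl G refl)
... | inj₂ (u , refl) = u , record
  { old = λ _ _ → mk⇔ id id
  ; leafˡ = λ x → mk⇔ (λ e → Finₚ.punchIn-injective v u x (to (nbr _) e)) (λ { refl → from (nbr _) refl })
  ; leafʳ = λ x → mk⇔ (λ e → Finₚ.punchIn-injective v u x (to (nbr _) (edge-sym G e)))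
                      (λ { refl → edge-sym G (from (nbr _) refl) })
  ; noLoop = edge-irrefl G refl
  }

insert-self : ∀ {m n} (i : Fin (suc m)) (j : Fin (suc n)) (π : Perm.Permutation m n) →
              Perm.insert i j π ⟨$⟩ʳ i ≡ j
insert-self i j π with i Fin.≟ i
... | yes _ = refl
... | no i≢i = contradiction refl i≢i

extend-iso : ∀ {n} {G′ H′ : Graph n} {G H : Graph (suc n)} {v w u x} →
  LeafExtension (Edge G′) (Edge G) v u → LeafExtension (Edge H′) (Edge H) w x →
  ((π , _) : G′ ≅ H′) → π ⟨$⟩ʳ u ≡ x → G ≅ H
extend-iso {n} {G′} {H′} {G} {H} {v} {w} {u} {x} extG extH (π , iso) πu≡x = ρ , edge⇔
  where
  module EG = LeafExtension extG
  module EH = LeafExtension extH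

  ρ : Permutation′ (suc n)
  ρ = Perm.insert v w π

  ρ-leaf : ρ ⟨$⟩ʳ v ≡ w
  ρ-leaf = insert-self v w π

  ρ-old : ∀ y → ρ ⟨$⟩ʳ punchIn v y ≡ punchIn w (π ⟨$⟩ʳ y)
  ρ-old = Perm.insert-punchIn v w π

  attached : ∀ y → u ≡ y ⇔ x ≡ π ⟨$⟩ʳ y
  attached y = mk⇔ (λ u≡y → trans (sym πu≡x) (cong (π ⟨$⟩ʳ_) u≡y))
    (λ x≡πy → trans (sym (inverseˡ π)) (trans (cong (π ⟨$⟩ˡ_) (trans πu≡x x≡πy)) (inverseˡ π)))

  edge⇔ : ∀ a b → Edge G a b ⇔ Edge H (ρ ⟨$⟩ʳ a) (ρ ⟨$⟩ʳ b)
  edge⇔ a b with leaf-or-old v a | leaf-or-old v b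
  ... | inj₁ refl | inj₁ refl = mk⇔ (λ e → contradiction e EG.noLoop)
        (λ e → contradiction e (edge-irrefl H refl))
  ... | inj₁ refl | inj₂ (y , refl) = subst₂ (λ c d → Edge G v (punchIn v y) ⇔ Edge H c d)
        (sym ρ-leaf) (sym (ρ-old y))
        (mk⇔ (from (EH.leafˡ _) ∘ to (attached y) ∘ to (EG.leafˡ y))
             (from (EG.leafˡ y) ∘ from (attached y) ∘ to (EH.leafˡ _)))
  ... | inj₂ (y , refl) | inj₁ refl = subst₂ (λ c d → Edge G (punchIn v y) v ⇔ Edge H c d)
        (sym (ρ-old y)) (sym ρ-leaf)
        (mk⇔ (from (EH.leafʳ _) ∘ to (attached y) ∘ to (EG.leafʳ y))
             (from (EG.leafʳ y) ∘ from (attached y) ∘ to (EH.leafʳ _)))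
  ... | inj₂ (y , refl) | inj₂ (z , refl) = 
        subst₂ (λ c d → Edge G (punchIn v y) (punchIn v z) ⇔ Edge H c d) (sym (ρ-old y)) (sym (ρ-old z))
        (mk⇔ (from (EH.old _ _) ∘ to (iso y z) ∘ to (EG.old y z))
             (from (EG.old y z) ∘ from (iso y z) ∘ to (EH.old _ _)))

toℕ-punchIn-fromℕ : ∀ {n} (x : Fin n) → toℕ (punchIn (fromℕ n) x) ≡ toℕ x
toℕ-punchIn-fromℕ zero = refl
toℕ-punchIn-fromℕ (suc x) = cong suc (toℕ-punchIn-fromℕ x)

-- Raising n and k together leaves `n ∸ k` unchanged, even definitionally, so the closing edge stays
-- in place and only the step from m to m + 1 is new.
P-extension : ∀ m k h h′ →
  LeafExtension (Edge (P (suc m) k h)) (Edge (P (2 + m) (suc k) h′)) (fromℕ (suc m)) (fromℕ m)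
P-extension m k h h′ = record
  { old = λ x y → mk⇔
      (λ { (fwd a) → fwd (subst₂ Arcℕ (toℕ-punchIn-fromℕ x) (toℕ-punchIn-fromℕ y) a)
         ; (bwd a) → bwd (subst₂ Arcℕ (toℕ-punchIn-fromℕ y) (toℕ-punchIn-fromℕ x) a) })
      (λ { (fwd a) → fwd (subst₂ Arcℕ (sym (toℕ-punchIn-fromℕ x)) (sym (toℕ-punchIn-fromℕ y)) a)
         ; (bwd a) → bwd (subst₂ Arcℕ (sym (toℕ-punchIn-fromℕ y)) (sym (toℕ-punchIn-fromℕ x)) a) })
  ; leafˡ = λ x → mk⇔ (λ { (fwd a) → contradiction a (¬leaving x) ; (bwd a) → entering x a })
      (λ { refl → bwd entering⁻ })
  ; leafʳ = λ x → mk⇔ (λ { (fwd a) → entering x a ; (bwd a) → contradiction a (¬leaving x) })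
      (λ { refl → fwd entering⁻ })
  ; noLoop = edge-irrefl (P (2 + m) (suc k) h′) refl
  }
  where
  Arcℕ : ℕ → ℕ → Set
  Arcℕ i j = (j ≡ suc i) ⊎ (i ≡ 0 × suc j ≡ suc m ∸ k)

  v = fromℕ (suc m)

  ¬leaving : ∀ x → ¬ Arc (2 + m) (suc k) v (punchIn v x)
  ¬leaving x (inj₁ eq) = ℕₚ.<⇒≢ (ℕₚ.<-trans (Finₚ.toℕ<n x) (ℕₚ.n<1+n (suc m)))
    (trans (sym (toℕ-punchIn-fromℕ x)) (trans eq (cong suc (Finₚ.toℕ-fromℕ (suc m)))))

  entering : ∀ x → Arc (2 + m) (suc k) (punchIn v x) v → fromℕ m ≡ x
  entering x (inj₁ eq) = Finₚ.toℕ-injective (trans (Finₚ.toℕ-fromℕ m)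
    (ℕₚ.suc-injective (trans (sym (Finₚ.toℕ-fromℕ (suc m))) (trans eq (cong suc (toℕ-punchIn-fromℕ x))))))
  -- The closing edge would have to end at position m + 1, but it ends at a position of at most m.
  entering x (inj₂ (_ , eq)) = contradiction
    (subst (_≤ suc m) (trans (sym eq) (cong suc (Finₚ.toℕ-fromℕ (suc m)))) (ℕₚ.m∸n≤m (suc m) k)) ℕₚ.1+n≰n

  entering⁻ : Arc (2 + m) (suc k) (punchIn v (fromℕ m)) v
  entering⁻ = inj₁ (trans (Finₚ.toℕ-fromℕ (suc m))
    (cong suc (sym (trans (toℕ-punchIn-fromℕ (fromℕ m)) (Finₚ.toℕ-fromℕ m)))))

module P-LeafCount m k h h′ =
  LeafCount (P (suc m) k h) (P (2+ m) (suc k) h′) (P-extension m k h h′)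

-- Connectivity, cut edges and degrees of P n k

k+3≤n⇒3≤n : ∀ k {n} → k + 3 ≤ n → 3 ≤ n
k+3≤n⇒3≤n k = ℕₚ.≤-trans (ℕₚ.m≤n+m 3 k)

P-connected : ∀ n k h → Connected (P n k h)
P-connected (suc m) k h u v = Star.reverse (edge-sym G) (reach u) ◅◅ reach v
  where
  G = P (suc m) k h

  path : ∀ i (i<n : i < suc m) → Star (Edge G) zero (fromℕ< i<n)
  path zero (s≤s _) = ε
  path (suc i) i<n = path i (ℕₚ.<⇒≤ i<n) ◅◅
    fwd (inj₁ (trans (Finₚ.toℕ-fromℕ< i<n) (cong suc (sym (Finₚ.toℕ-fromℕ< (ℕₚ.<⇒≤ i<n)))))) ◅ ε

  reach : ∀ x → Star (Edge G) zero x
  reach x = subst (Star (Edge G) zero) (Finₚ.fromℕ<-toℕ x (Finₚ.toℕ<n x)) (path (toℕ x) (Finₚ.toℕ<n x))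
P-connected zero k h ()

-- The neighbours are 1 and m at position 0, m - 1 and 0 at position m, and i - 1 and i + 1 at any
-- other i. At both ends `2≤m` keeps the two apart.
cycle-regular : ∀ m h u → deg (P (suc m) 0 h) u ≡ 2
cycle-regular m h@(s≤s 2≤m) u = by-position (toℕ u) refl
  where
  G = P (suc m) 0 h

  neighboursℕ : ∀ {i j} → i < suc m → j < suc m → i ≢ j →
    (∀ x → Edge G u x ⇔ (i ≡ toℕ x ⊎ j ≡ toℕ x)) → deg G u ≡ 2
  neighboursℕ i<n j<n i≢j nbr = two-neighbours G
    (λ eq → i≢j (trans (sym (Finₚ.toℕ-fromℕ< i<n)) (trans (cong toℕ eq) (Finₚ.toℕ-fromℕ< j<n))))
    λ x → mk⇔
      (λ e → Sum.map (λ eq → Finₚ.toℕ-injective (trans (Finₚ.toℕ-fromℕ< i<n) eq))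
                     (λ eq → Finₚ.toℕ-injective (trans (Finₚ.toℕ-fromℕ< j<n) eq)) (to (nbr x) e))
      (λ eq → from (nbr x) (Sum.map (λ eq → trans (sym (Finₚ.toℕ-fromℕ< i<n)) (cong toℕ eq))
                                    (λ eq → trans (sym (Finₚ.toℕ-fromℕ< j<n)) (cong toℕ eq)) eq))

  0<m : 0 < m
  0<m = ℕₚ.<⇒≤ 2≤m

  by-position : ∀ i → toℕ u ≡ i → deg G u ≡ 2
  by-position zero u≡0 = neighboursℕ {1} {m} (s≤s 0<m) ℕₚ.≤-refl (ℕₚ.<⇒≢ 2≤m) λ x → mk⇔
    (λ { (fwd (inj₁ x≡1+u)) → inj₁ (sym (trans x≡1+u (cong suc u≡0)))
       ; (fwd (inj₂ (_ , 1+x≡n))) → inj₂ (sym (ℕₚ.suc-injective 1+x≡n))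
       ; (bwd (inj₁ u≡1+x)) → contradiction (trans (sym u≡0) u≡1+x) λ ()
       ; (bwd (inj₂ (_ , 1+u≡n))) → contradiction (trans (sym u≡0) (ℕₚ.suc-injective 1+u≡n)) (ℕₚ.<⇒≢ 0<m) })
    (λ { (inj₁ 1≡x) → fwd (inj₁ (trans (sym 1≡x) (cong suc (sym u≡0))))
       ; (inj₂ m≡x) → fwd (inj₂ (u≡0 , cong suc (sym m≡x))) })
  by-position (suc i) u≡1+i with ℕₚ.m≤n⇒m<n∨m≡n (subst (_≤ m) u≡1+i (s≤s⁻¹ (Finₚ.toℕ<n u)))
  ... | inj₁ 1+i<m = neighboursℕ {i} {2 + i}
      (ℕₚ.<-trans (ℕₚ.n<1+n i) (ℕₚ.<-trans 1+i<m (ℕₚ.n<1+n m))) (s≤s 1+i<m)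
      (ℕₚ.<⇒≢ (ℕₚ.<-trans (ℕₚ.n<1+n i) (ℕₚ.n<1+n (suc i)))) λ x → mk⇔
    (λ { (fwd (inj₁ x≡1+u)) → inj₂ (sym (trans x≡1+u (cong suc u≡1+i)))
       ; (fwd (inj₂ (u≡0 , _))) → contradiction (trans (sym u≡0) u≡1+i) λ ()
       ; (bwd (inj₁ u≡1+x)) → inj₁ (ℕₚ.suc-injective (trans (sym u≡1+i) u≡1+x))
       ; (bwd (inj₂ (_ , 1+u≡n))) → contradiction (trans (sym u≡1+i) (ℕₚ.suc-injective 1+u≡n)) (ℕₚ.<⇒≢ 1+i<m) })
    (λ { (inj₁ i≡x) → bwd (inj₁ (trans u≡1+i (cong suc i≡x)))
       ; (inj₂ 2+i≡x) → fwd (inj₁ (trans (sym 2+i≡x) (cong suc (sym u≡1+i)))) })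
  ... | inj₂ 1+i≡m = neighboursℕ {i} {0}
      (ℕₚ.<-trans (ℕₚ.n<1+n i) (subst (suc i <_) (cong suc 1+i≡m) ℕₚ.≤-refl)) (s≤s z≤n)
      (λ { refl → ℕₚ.<⇒≢ 2≤m 1+i≡m }) λ x → mk⇔
    (λ { (fwd (inj₁ x≡1+u)) → contradiction
           (trans x≡1+u (cong suc (trans u≡1+i 1+i≡m))) (ℕₚ.<⇒≢ (Finₚ.toℕ<n x))
       ; (fwd (inj₂ (u≡0 , _))) → contradiction (trans (sym u≡0) u≡1+i) λ ()
       ; (bwd (inj₁ u≡1+x)) → inj₁ (ℕₚ.suc-injective (trans (sym u≡1+i) u≡1+x))
       ; (bwd (inj₂ (x≡0 , _))) → inj₂ (sym x≡0) })
    (λ { (inj₁ i≡x) → bwd (inj₁ (trans u≡1+i (cong suc i≡x)))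
       ; (inj₂ 0≡x) → bwd (inj₂ (sym 0≡x , cong suc (trans u≡1+i 1+i≡m))) })

regular⇒¬cutEdge : ∀ {n} (G : Graph n) → Connected G → (∀ u → deg G u ≡ 2) → ∀ u v → ¬ CutEdge G u v
regular⇒¬cutEdge G conn regular u v cut = CycleProperties.¬cutEdge
  (Walk.hamiltonCycle G regular (edge-sym G (proj₁ cut))) conn cut

P-hasCutEdges : ∀ n k h → HasCutEdges (P n k h) k
P-hasCutEdges zero zero ()
P-hasCutEdges zero (suc k) ()
P-hasCutEdges (suc m) zero h = [] , [] , (λ u v → mk⇔ (λ ())
  (λ (_ , cut) → contradiction cut
    (regular⇒¬cutEdge (P (suc m) 0 h) (P-connected _ 0 h) (cycle-regular m h) u v))) , refl
P-hasCutEdges (suc zero) (suc k) (s≤s h) = contradiction (k+3≤n⇒3≤n k h) λ ()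
P-hasCutEdges (2+ m) (suc k) h@(s≤s h′) = LeafCutEdges.hasCutEdges⁺
  (P (suc m) k h′) (P (2+ m) (suc k) h) (P-extension m k h′ h) (P-connected (suc m) k h′)
  (P-hasCutEdges (suc m) k h′)

trace-adj²-P : ∀ n k h → trace (adj² (P n k h)) ≡ n * 2
trace-adj²-P zero zero ()
trace-adj²-P zero (suc k) ()
trace-adj²-P (suc m) zero h = trans (trace-adj² (P (suc m) 0 h)) (trans (∑-cong (cycle-regular m h)) (∑-const 2))
trace-adj²-P (suc zero) (suc k) (s≤s h) = contradiction (k+3≤n⇒3≤n k h) λ ()
trace-adj²-P (2+ m) (suc k) h@(s≤s h′) = trans
  (P-LeafCount.trace-adj²-leaf m k h′ h) (cong (2 +_) (trace-adj²-P (suc m) k h′))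

-- Each new leaf raises the degree of the previous last vertex, which is at least 1 by
-- connectedness, to at least 2.
P-last-or-deg≥2 : ∀ m k h (x : Fin (suc m)) → x ≡ fromℕ m ⊎ 2 ≤ deg (P (suc m) k h) x
P-last-or-deg≥2 m zero h x = inj₂ (ℕₚ.≤-reflexive (sym (cycle-regular m h x)))
P-last-or-deg≥2 zero (suc k) (s≤s h) x = contradiction (k+3≤n⇒3≤n k h) λ ()
P-last-or-deg≥2 (suc m) (suc k) h@(s≤s h′) x with leaf-or-old (fromℕ (suc m)) x
... | inj₁ x≡last = inj₁ x≡last
... | inj₂ (y , refl) = inj₂ (subst (2 ≤_) (sym (P-LeafCount.deg-old m k h′ h y))
    (bound (P-last-or-deg≥2 m k h′ y)))
  where
  bound : y ≡ fromℕ m ⊎ 2 ≤ deg (P (suc m) k h′) y → 2 ≤ δ (fromℕ m) y + deg (P (suc m) k h′) y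
  bound (inj₂ 2≤deg) = ℕₚ.≤-trans 2≤deg (ℕₚ.m≤n+m _ _)
  bound (inj₁ refl) = subst (λ a → 2 ≤ a + deg (P (suc m) k h′) y) (sym (δ-diag y))
    (s≤s (connected⇒0<deg (P (suc m) k h′) (P-connected (suc m) k h′)
      (ℕₚ.<⇒≤ (s≤s⁻¹ (k+3≤n⇒3≤n k h′))) y))

P-deg-last : ∀ m k h → deg (P (suc m) (suc k) h) (fromℕ m) ≡ 1
P-deg-last zero k (s≤s h) = contradiction (k+3≤n⇒3≤n k h) λ ()
P-deg-last (suc m) k h@(s≤s h′) = P-LeafCount.deg-leaf m k h′ h

-- The walk may begin with any edge at `b`, so `b` can be made the last vertex. Applied to the cycle
-- itself, this moves any vertex to the place where the path is attached.
regular⇒cycle : ∀ {m} (G : Graph (suc m)) (h : 3 ≤ suc m) → Connected G → (∀ u → deg G u ≡ 2) →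
  ∀ b → Σ[ iso ∈ G ≅ P (suc m) 0 h ] proj₁ iso ⟨$⟩ʳ b ≡ fromℕ m
regular⇒cycle {m} G h conn regular b =
  let a , ba = deg-pos⁻ G (subst (0 <_) (sym (regular b)) (s≤s z≤n))
      iso , last = cycle-iso (Walk.hamiltonCycle G regular ba) conn h
  in iso , Finₚ.toℕ-injective (trans (ℕₚ.suc-injective last) (sym (Finₚ.toℕ-fromℕ m)))

-- Attaching a leaf to x creates more closed walks of length 4 than attaching
-- it to the last vertex, or amounts to the same.
P-attach : ∀ m k h (x : Fin (suc m)) → let G = P (suc m) k h in
  (1 ≤ k × deg G (fromℕ m) < deg G x) ⊎ (Σ[ iso ∈ G ≅ G ] proj₁ iso ⟨$⟩ʳ x ≡ fromℕ m)
P-attach m zero h x = inj₂ (regular⇒cycle (P (suc m) 0 h) h (P-connected _ 0 h) (cycle-regular m h) x)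
P-attach m (suc k) h x with P-last-or-deg≥2 m (suc k) h x
... | inj₁ refl = inj₂ ((Perm.id , λ _ _ → mk⇔ id id) , refl)
... | inj₂ 2≤deg = inj₁ (s≤s z≤n , subst (_< deg (P (suc m) (suc k) h) x) (sym (P-deg-last m k h)) 2≤deg)

-- A trichotomy that survives attaching a leaf to both graphs. The bound `2 ≤ k` ensures that S₄ is
-- among the moments compared.
data Comparison {n} (k : ℕ) (H G : Graph n) : Set where
  more-edges : trace (adj² H) < trace (adj² G) → Comparison k H G
  more-walks : 2 ≤ k → trace (adj² H) ≡ trace (adj² G) → trace (adj³ H) ≡ trace (adj³ G) →
               trace (adj⁴ H) < trace (adj⁴ G) → Comparison k H G
  isomorphic : G ≅ H → Comparison k H G

∑-lower-bound : ∀ {n} c (f : Fin n → ℕ) → (∀ x → c ≤ f x) → n * c < ∑ f ⊎ (∀ x → f x ≡ c)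
∑-lower-bound {zero} c f c≤f = inj₂ λ ()
∑-lower-bound {suc n} c f c≤f with ∑-lower-bound c (f ∘ suc) (c≤f ∘ suc) | ℕₚ.m≤n⇒m<n∨m≡n (c≤f zero)
... | inj₁ lt | _ = inj₁ (subst (_ <_) (sym (∑-suc f)) (ℕₚ.+-mono-≤-< (c≤f zero) lt))
... | inj₂ eq | inj₁ lt = inj₁ (subst (_ <_) (sym (∑-suc f))
      (ℕₚ.+-mono-<-≤ lt (ℕₚ.≤-reflexive (sym (trans (∑-cong eq) (∑-const c))))))
... | inj₂ eq | inj₂ c≡f0 = inj₂ λ { zero → sym c≡f0 ; (suc x) → eq x }

module _ {m k} (h : k + 3 ≤ suc m) (G : Graph (suc m)) (conn : Connected G)
  (cuts : HasCutEdges G k) where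

  private
    2≤m : 2 ≤ m
    2≤m = s≤s⁻¹ (k+3≤n⇒3≤n k h)

  compare-leafless : (∀ v → deg G v ≢ 1) → Comparison k (P (suc m) k h) G
  compare-leafless leafless with ∑-lower-bound 2 (deg G)
      (λ v → ℕₚ.≤∧≢⇒< (connected⇒0<deg G conn (ℕₚ.<⇒≤ 2≤m) v) (leafless v ∘ sym))
  ... | inj₁ lt = more-edges (subst₂ _<_ (sym (trace-adj²-P (suc m) k h)) (sym (trace-adj² G)) lt)
  ... | inj₂ regular = regular-case k h cuts
    where
    regular-case : ∀ k h → HasCutEdges G k → Comparison k (P (suc m) k h) G
    regular-case zero h _ = isomorphic (proj₁ (regular⇒cycle G h conn regular zero))
    -- With k > 0 the list of cut edges has a head, which a 2-regular connected graph cannot have.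
    regular-case (suc k) h ((u , v) ∷ _ , _ , es⇔ , _) =
      contradiction (proj₂ (to (es⇔ u v) (here refl))) (regular⇒¬cutEdge G conn regular u v)

module _ {n k : ℕ} (H′ G′ : Graph n) (H G : Graph (suc n)) {w x v u}
  (extH : LeafExtension (Edge H′) (Edge H) w x) (extG : LeafExtension (Edge G′) (Edge G) v u) where

  private
    module CH = LeafCount H′ H extH
    module CG = LeafCount G′ G extG

    trace-adj²-mono : trace (adj² H′) < trace (adj² G′) → trace (adj² H) < trace (adj² G)
    trace-adj²-mono lt = subst₂ _<_ (sym CH.trace-adj²-leaf) (sym CG.trace-adj²-leaf) (ℕₚ.+-monoʳ-< 2 lt)

    trace-adj²-cong : trace (adj² H′) ≡ trace (adj² G′) → trace (adj² H) ≡ trace (adj² G)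
    trace-adj²-cong eq = trans CH.trace-adj²-leaf (trans (cong (2 +_) eq) (sym CG.trace-adj²-leaf))

    trace-adj³-cong : trace (adj³ H′) ≡ trace (adj³ G′) → trace (adj³ H) ≡ trace (adj³ G)
    trace-adj³-cong eq = trans CH.trace-adj³-leaf (trans eq (sym CG.trace-adj³-leaf))

    trace-adj⁴-mono : 2 + 4 * deg H′ x + trace (adj⁴ H′) < 2 + 4 * deg G′ u + trace (adj⁴ G′) →
                      trace (adj⁴ H) < trace (adj⁴ G)
    trace-adj⁴-mono = subst₂ _<_ (sym CH.trace-adj⁴-leaf) (sym CG.trace-adj⁴-leaf)

  -- An excess in S₂ persists, since each leaf adds 2 on both sides. An excess in S₄ persists if `H`
  -- is extended at a vertex of no larger degree. If `G′` and `H′` agree, the place of the new leaf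
  -- decides, and that is the role of the second hypothesis.
  compare-leaf :
    (1 ≤ k → deg H′ x ≤ deg G′ u) →
    (∀ y → (1 ≤ k × deg H′ x < deg H′ y) ⊎ (Σ[ iso ∈ H′ ≅ H′ ] proj₁ iso ⟨$⟩ʳ y ≡ x)) →
    Comparison k H′ G′ → Comparison (suc k) H G
  compare-leaf deg≤ attach (more-edges lt) = more-edges (trace-adj²-mono lt)
  compare-leaf deg≤ attach (more-walks 2≤k eq₂ eq₃ lt) = more-walks (ℕₚ.m≤n⇒m≤1+n 2≤k)
    (trace-adj²-cong eq₂) (trace-adj³-cong eq₃)
    (trace-adj⁴-mono (ℕₚ.+-mono-≤-< (ℕₚ.+-monoʳ-≤ 2 (ℕₚ.*-monoʳ-≤ 4 (deg≤ (ℕₚ.<⇒≤ 2≤k)))) lt))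
  compare-leaf deg≤ attach (isomorphic iso@(π , _)) with attach (π ⟨$⟩ʳ u)
  ... | inj₂ (ρ , ρπu≡x) = isomorphic 
    (extend-iso {G′ = G′} {H′} {G} {H} extG extH (≅-trans {G = G′} {H′} {H′} iso ρ) ρπu≡x)
  -- The only origin of a strict inequality in S₄: a misplaced leaf on a graph with k ≥ 1, which
  -- leaves at least two cut edges.
  ... | inj₁ (1≤k , lt) = more-walks (s≤s 1≤k)
    (trace-adj²-cong (sym (trace-adj²-iso {G = G′} {H′} iso)))
    (trace-adj³-cong (sym (trace-adj³-iso {G = G′} {H′} iso)))
    (trace-adj⁴-mono (ℕₚ.+-mono-<-≤
      (ℕₚ.+-monoʳ-< 2 (ℕₚ.*-monoʳ-< 4 (subst (deg H′ x <_) (sym (deg-iso {G = G′} {H′} iso u)) lt)))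
      (ℕₚ.≤-reflexive (sym (trace-adj⁴-iso {G = G′} {H′} iso)))))

compare : ∀ m k (h : k + 3 ≤ suc m) (G : Graph (suc m)) → Connected G → HasCutEdges G k →
          Comparison k (P (suc m) k h) G
compare m k h G conn cuts with Finₚ.any? (λ v → deg G v ℕ.≟ 1)
... | no leafless = compare-leafless h G conn cuts λ v d → leafless (v , d)
compare zero k h G conn cuts | yes _ = contradiction (k+3≤n⇒3≤n k h) λ { (s≤s ()) }
compare (suc m) k h G conn cuts | yes (v , d) with u , ext ← remove-leaf G d
  with conn′ ← LeafConnectivity.connected⁻ ext conn
  with LeafCutEdges.hasCutEdges⁻ (remove G v) G ext conn′ cuts
... | l , refl , cuts′ = compare-leaf
  (P (suc m) l (s≤s⁻¹ h)) (remove G v) (P (2+ m) (suc l) h) G (P-extension m l (s≤s⁻¹ h) h) ext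
  -- Matching on `1 ≤ l` exposes l = 1 + j, so the last vertex has degree 1, and connectedness gives
  -- `u` at least that.
  (λ { (s≤s {n = j} _) → subst (_≤ deg (remove G v) u) (sym (P-deg-last m j (s≤s⁻¹ h)))
         (connected⇒0<deg (remove G v) conn′ (ℕₚ.<⇒≤ (s≤s⁻¹ (k+3≤n⇒3≤n l (s≤s⁻¹ h)))) u) })
  (P-attach m l (s≤s⁻¹ h))
  (compare m l (s≤s⁻¹ h) (remove G v) conn′ cuts′)

-- From traces to the S-order

module _ {c ℓ₁ ℓ₂} (ℝ : RealNumbers c ℓ₁ ℓ₂) where

  open RealNumbers ℝ using (isStrictPartialOrder)
    renaming (_<_ to _<ᴿ_; _≈_ to _≈ᴿ_; sym to symᴿ; trans to transᴿ; reflexive to reflexiveᴿ)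
  open Spectral ℝ
  open Moments ℝ
  open IsStrictPartialOrder isStrictPartialOrder using (<-resp-≈)

  private
    ≈⟦⟧-≡ : ∀ {x y a b} → x ≈ᴿ ⟦ a ⟧ → y ≈ᴿ ⟦ b ⟧ → a ≡ b → x ≈ᴿ y
    ≈⟦⟧-≡ x≈ y≈ a≡b = transᴿ x≈ (transᴿ (reflexiveᴿ (cong ⟦_⟧ a≡b)) (symᴿ y≈))

    ≈⟦⟧-< : ∀ {x y a b} → x ≈ᴿ ⟦ a ⟧ → y ≈ᴿ ⟦ b ⟧ → a < b → x <ᴿ y
    ≈⟦⟧-< x≈ y≈ a<b = proj₁ <-resp-≈ (symᴿ y≈) (proj₂ <-resp-≈ (symᴿ x≈) (⟦⟧-< a<b))

  comparison⇒≺ₛ : ∀ {n k} {H G : Graph n} → k + 3 ≤ n → ¬ (G ≅ H) → Comparison k H G → H ≺ₛ G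
  comparison⇒≺ₛ h ¬iso (isomorphic iso) _ _ = contradiction iso ¬iso
  comparison⇒≺ₛ {n} {k} {H} {G} h _ (more-edges lt) Λ₁ Λ₂ = 2 , s≤s z≤n ,
    ℕₚ.∸-monoˡ-≤ 1 (k+3≤n⇒3≤n k h) , lower , ≈⟦⟧-< (S₂ Λ₁) (S₂ Λ₂) lt
    where
    lower : ∀ i → i < 2 → S i Λ₁ ≈ᴿ S i Λ₂
    lower 0 _ = ≈⟦⟧-≡ {a = trace {n} δ} (S₀ Λ₁) (S₀ Λ₂) refl
    lower 1 _ = ≈⟦⟧-≡ (S₁ Λ₁) (S₁ Λ₂) (trans (trace-adj H) (sym (trace-adj G)))
    lower (2+ _) (s≤s (s≤s ()))
  comparison⇒≺ₛ {n} {k} {H} {G} h _ (more-walks 2≤k eq₂ eq₃ lt) Λ₁ Λ₂ = 4 , s≤s z≤n ,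
    -- From 2 ≤ k and k + 3 ≤ n there are at least five vertices, so index 4 is admissible.
    ℕₚ.∸-monoˡ-≤ 1 (ℕₚ.≤-trans (ℕₚ.+-monoˡ-≤ 3 2≤k) h) , lower , ≈⟦⟧-< (S₄ Λ₁) (S₄ Λ₂) lt
    where
    lower : ∀ i → i < 4 → S i Λ₁ ≈ᴿ S i Λ₂
    lower 0 _ = ≈⟦⟧-≡ {a = trace {n} δ} (S₀ Λ₁) (S₀ Λ₂) refl
    lower 1 _ = ≈⟦⟧-≡ (S₁ Λ₁) (S₁ Λ₂) (trans (trace-adj H) (sym (trace-adj G)))
    lower 2 _ = ≈⟦⟧-≡ (S₂ Λ₁) (S₂ Λ₂) eq₂
    lower 3 _ = ≈⟦⟧-≡ (S₃ Λ₁) (S₃ Λ₂) eq₃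
    lower (suc (suc (2+ _))) (s≤s (s≤s (s≤s (s≤s ()))))

theorem3p1 : ∀ {c ℓ₁ ℓ₂ : Level} (ℝ : RealNumbers c ℓ₁ ℓ₂) (n k : ℕ) (h : k + 3 ≤ n) →
    𝒢 n k (P n k h)
    × ((G : Graph n) → 𝒢 n k G → ¬ (G ≅ P n k h) → Spectral._≺ₛ_ ℝ (P n k h) G)
theorem3p1 ℝ zero k h = contradiction (k+3≤n⇒3≤n k h) λ ()
theorem3p1 ℝ (suc m) k h = (P-connected (suc m) k h , P-hasCutEdges (suc m) k h) ,
  λ G (conn , cuts) ¬iso → comparison⇒≺ₛ ℝ h ¬iso (compare m k h G conn cuts)
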